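{- For each $d,r\in\mathbb{N}_+$ and each $\omega\in\mathbb{N}_+$ with $\omega\ge2$, there exist finite, interface-respecting instructive DP-cores, each with some cleaning function and equipped with witness actions, denoted $\mathsf{MaxDeg}_{\ge d}$, $\mathsf{Chrom}_{\le r}$, $\mathsf{SimpleClique}_{\ge\omega}$, $\mathsf{HasMultipleEdges}$, such that: 1. $\mathsf{MaxDeg}_{\ge d}$ has bit-length $O(k\log(d+1))$ and $\mathcal{P}(\mathsf{MaxDeg}_{\ge d})$ is the property of graphs with maximum degree at least $d$; 2. $\mathsf{Chrom}_{\le r}$ has bit-length $O(k\log(r+1))$ and $\mathcal{P}(\mathsf{Chrom}_{\le r})$ is the property of $r$-colorable graphs; 3. $\mathsf{SimpleClique}_{\ge\omega}$ has bit-length $O(k\log\omega)$ and $\mathcal{P}(\mathsf{SimpleClique}_{\ge\omega})\cap\mathcal{S}=\mathcal{C}_\omega\cap\mathcal{S}$, where $\mathcal{S}$ is the set of simple graphs (graphs with no multiple edges) and $\mathcal{C}_\omega$ is the property of graphs containing a clique of size $\omega$; 4. $\mathsf{HasMultipleEdges}$ has bit-length $O(k^2)$ and $\mathcal{P}(\mathsf{HasMultipleEdges})$ is the property of graphs having a multiple edge. Moreover, the cores in items 1, 2 and 4 are coherent.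
   Context: Graphs are triples $(V,E,\rho)$, $V,E$ finite subsets of $\mathbb{N}$, $\rho\subseteq E\times V$, each edge incident to exactly two distinct vertices; a multiple edge is a pair of distinct edges with the same endpoints; simple graphs have none. Graph properties are isomorphism-closed sets of graphs. The empty graph has maximum degree $0$; $r$-colorable means the vertex set has a partition into at most $r$ cells with the endpoints of every edge in distinct cells. Instructive decompositions: the $k$-instructive alphabet has $\mathtt{Leaf}$ (arity 0), $\mathtt{IntroVertex}_u,\mathtt{ForgetVertex}_u$ ($u\in[k+1]$), $\mathtt{IntroEdge}_{u,v}$ (distinct $u,v$) of arity 1 and $\mathtt{Join}$ of arity 2; $\mathcal{T}_k$ is the set of terms legal w.r.t. bags (Leaf: $\emptyset$; IntroVertex$_u$ needs $u\notin$ bag, adds it; ForgetVertex$_u$ needs $u\in$ bag, removes it; IntroEdge$_{u,v}$ needs $u,v\in$ bag; Join needs equal child bags). $G(\tau)$: Leaf gives the empty graph; IntroVertex$_u$ adds a fresh isolated vertex labeled $u$; ForgetVertex$_u$ drops label $u$; IntroEdge$_{u,v}$ adds a new edge between the vertices labeled $u,v$; Join is the disjoint union of children with vertices carrying the same bag label identified (edges never identified). An (instructive) DP-core $\mathsf{D}$ assigns to each $k\in\mathbb{N}$ a tuple $\mathsf{D}[k]$: a decidable set $\mathcal{W}_k\subseteq\{0,1\}^*$ of witnesses, $\mathtt{Final}_k:\mathcal{W}_k\to\{0,1\}$, a finite $\mathtt{Leaf}_k\subseteq\mathcal{W}_k$, transitions $\mathtt{IntroVertex}_u,\mathtt{ForgetVertex}_u,\mathtt{IntroEdge}_{u,v}:\mathcal{W}_k\to$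 finite subsets, $\mathtt{Join}:\mathcal{W}_k^2\to$ finite subsets (lifted to sets by union), a cleaning function $\mathtt{Clean}_k$ on finite subsets (and an invariant function, irrelevant here). $\mathrm{Dyn}_k(\tau)$ is $\mathtt{Leaf}_k$ at leaves and $\mathtt{Clean}_k$ of the lifted transition applied to children's dynamizations otherwise; $\mathsf{D}[k]$ accepts $\tau$ if $\mathrm{Dyn}_k(\tau)$ has a final witness; $\mathcal{P}(\mathsf{D})=\bigcup_k$ iso-closure of $\{G(\tau):\tau\in\mathcal{T}_k$ accepted by $\mathsf{D}[k]\}$. Finite: each $\mathcal{W}_k$ is finite. Bit-length $O(g(k))$: every witness of $\mathsf{D}[k]$ can be encoded with $O(g(k))$ bits. Coherent: for $\tau\in\mathcal{T}_k,\tau'\in\mathcal{T}_{k'}$ with $G(\tau)\cong G(\tau')$, $\mathsf{D}[k]$ accepts $\tau$ iff $\mathsf{D}[k']$ accepts $\tau'$. Labels: each witness $w$ has a label set $\mathrm{Lbl}_k(w)\subseteq[k+1]$, $\mathrm{Lbl}_k(S)=\bigcup_{w\in S}\mathrm{Lbl}_k(w)$. Interface-respecting: $\mathrm{Lbl}_k(\mathtt{Leaf}_k)=\emptyset$, and whenever $\mathrm{Lbl}_k(S),\mathrm{Lbl}_k(S')\subseteq b$: $\mathrm{Lbl}_k(\mathtt{IntroVertex}_u(S))\subseteq b\cup\{u\}$ ($u\notin b$), $\mathrm{Lbl}_k(\mathtt{ForgetVertex}_u(S))\subseteq b\setminus\{u\}$ ($u\in b$), $\mathrm{Lbl}_k(\mathtt{IntroEdge}_{u,v}(S))\subseteq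 b$ ($u,v\in b$), $\mathrm{Lbl}_k(\mathtt{Join}(S,S'))\subseteq b$, $\mathrm{Lbl}_k(\mathtt{Clean}_k(S))\subseteq b$. With $\mathcal{F}_k$ the set of injective $f:b\to[k+1]$ ($b\subseteq[k+1]$), a witness action for $\mathsf{D}[k]$ is a partial map $\rho(f,w)\in\mathcal{W}_k$ defined iff $\mathrm{Lbl}_k(w)\subseteq\mathrm{dom}(f)$ (pointwise on sets), preserving finality, with $\mathrm{Lbl}_k(\rho(f,w))=f(\mathrm{Lbl}_k(w))$, $\rho(f^{ -1},\rho(f,w))=w$, $\rho(f\circ f',w)=\rho(f,\rho(f',w))$, $\rho(f',w)=\rho(f,w)$ if $f'$ extends $f$, and $\rho(f,\cdot)$ commuting with the transitions (relabeling the labels of the transitions by $f$). Equipped with witness actions: one for each $\mathsf{D}[k]$. -}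

module Defs where

open import Data.Nat using (ℕ; zero; suc; _+_; _*_; _≤_; _⊔_)
open import Data.Nat.Properties using () renaming (_≟_ to _≟ℕ_)
open import Data.Bool using (Bool; true; false; T; if_then_else_)
open import Data.Fin using (Fin)
open import Data.Fin.Properties using () renaming (_≟_ to _≟F_)
open import Data.Fin.Subset using (Subset; Side; inside; outside; _∈_; _∉_; _⊆_; _∪_; _─_; ⁅_⁆)
  renaming (⊥ to ∅)
open import Data.Vec using (_[_]≔_)
open import Data.List using (List; []; _∷_; _++_; map; concatMap; filter; length; foldr; deduplicate; allFin)
open import Data.List.Membership.Propositional using () renaming (_∈_ to _∈L_)
open import Data.List.Membership.DecPropositional using () renaming (_∈?_ to ∈?-with)
open import Data.List.Relation.Unary.All using (All)
open import Data.List.Relation.Unary.Any using (Any)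
open import Data.List.Relation.Unary.Unique.Propositional using (Unique)
open import Data.Maybe using (Maybe; just; nothing; _>>=_)
open import Data.Product using (Σ; ∃; ∃₂; _×_; _,_; proj₁; proj₂)
open import Data.Product.Properties using () renaming (≡-dec to ×-≡-dec)
open import Data.Sum using (_⊎_)
open import Relation.Binary.PropositionalEquality using (_≡_; _≢_)
open import Relation.Binary.Definitions using (DecidableEquality)
open import Relation.Nullary using (¬_; does)
open import Relation.Unary using (Decidable)

infix 3 _⇔_
_⇔_ : Set → Set → Set
A ⇔ B = (A → B) × (B → A)

-- Graphs (V , E , ρ) with V, E finite subsets of ℕ and ρ ⊆ E × V.
-- Finite sets are represented by lists, read as sets via membership
-- (duplicates are irrelevant everywhere below).

record RawGraph : Set where
  constructor mkGraph
  field
    V : List ℕ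
    E : List ℕ
    ρ : List (ℕ × ℕ)
open RawGraph public

record IsGraph (G : RawGraph) : Set where
  field
    ρ⊆E×V : ∀ {e v} → (e , v) ∈L ρ G → (e ∈L E G) × (v ∈L V G)
    twoEnds : ∀ {e} → e ∈L E G →
      ∃₂ λ u v → (u ≢ v) × ((e , u) ∈L ρ G) × ((e , v) ∈L ρ G)
        × (∀ w → (e , w) ∈L ρ G → (w ≡ u) ⊎ (w ≡ v))

record _≅_ (G H : RawGraph) : Set where
  field
    fV gV fE gE : ℕ → ℕ
    fV∈ : ∀ {v} → v ∈L V G → fV v ∈L V H
    gV∈ : ∀ {v} → v ∈L V H → gV v ∈L V G
    gfV : ∀ {v} → v ∈L V G → gV (fV v) ≡ v
    fgV : ∀ {v} → v ∈L V H → fV (gV v) ≡ v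
    fE∈ : ∀ {e} → e ∈L E G → fE e ∈L E H
    gE∈ : ∀ {e} → e ∈L E H → gE e ∈L E G
    gfE : ∀ {e} → e ∈L E G → gE (fE e) ≡ e
    fgE : ∀ {e} → e ∈L E H → fE (gE e) ≡ e
    pres : ∀ {e v} → e ∈L E G → v ∈L V G →
      ((e , v) ∈L ρ G ⇔ (fE e , fV v) ∈L ρ H)

_≟ℕ×ℕ_ : DecidableEquality (ℕ × ℕ)
_≟ℕ×ℕ_ = ×-≡-dec _≟ℕ_ _≟ℕ_

degree : RawGraph → ℕ → ℕ
degree G v = length (deduplicate _≟ℕ_ (filter (λ e → ∈?-with _≟ℕ×ℕ_ (e , v) (ρ G)) (E G)))

-- maximum degree (0 for the empty graph)
maxDegree : RawGraph → ℕ
maxDegree G = foldr _⊔_ 0 (map (degree G) (V G))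

Colorable : ℕ → RawGraph → Set
Colorable r G = Σ ((v : ℕ) → v ∈L V G → Fin r) λ c →
  ∀ {e u v} (pu : u ∈L V G) (pv : v ∈L V G) → e ∈L E G →
    (e , u) ∈L ρ G → (e , v) ∈L ρ G → u ≢ v → c u pu ≢ c v pv

Adjacent : RawGraph → ℕ → ℕ → Set
Adjacent G x y = ∃ λ e → (e ∈L E G) × ((e , x) ∈L ρ G) × ((e , y) ∈L ρ G)

HasClique : ℕ → RawGraph → Set
HasClique ω G = ∃ λ (K : List ℕ) → Unique K × (length K ≡ ω) × All (_∈L V G) K
  × (∀ {x y} → x ∈L K → y ∈L K → x ≢ y → Adjacent G x y)

HasMultipleEdge : RawGraph → Set
HasMultipleEdge G = ∃₂ λ e e' → (e ∈L E G) × (e' ∈L E G) × (e ≢ e')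
  × (∀ v → (e , v) ∈L ρ G ⇔ (e' , v) ∈L ρ G)

Simple : RawGraph → Set
Simple G = ¬ HasMultipleEdge G

data Term (k : ℕ) : Set where
  Leaf : Term k
  IntroVertex ForgetVertex : Fin (suc k) → Term k → Term k
  IntroEdge : Fin (suc k) → Fin (suc k) → Term k → Term k
  Join : Term k → Term k → Term k

Bag : ℕ → Set
Bag k = Subset (suc k)

-- Legal b τ : τ is legal with root bag b ; 𝒯_k = { τ | ∃ b . Legal b τ }
data Legal {k : ℕ} : Bag k → Term k → Set where
  Leaf : Legal ∅ Leaf
  IntroVertex : ∀ {b τ} u → u ∉ b → Legal b τ → Legal (b [ u ]≔ inside) (IntroVertex u τ)
  ForgetVertex : ∀ {b τ} u → u ∈ b → Legal b τ → Legal (b [ u ]≔ outside) (ForgetVertex u τ)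
  IntroEdge : ∀ {b τ} u v → u ≢ v → u ∈ b → v ∈ b → Legal b τ → Legal b (IntroEdge u v τ)
  Join : ∀ {b τ τ'} → Legal b τ → Legal b τ' → Legal b (Join τ τ')

-- G(τ): built with concrete fresh names (only its isomorphism type matters)
record LGraph (k : ℕ) : Set where
  field
    graph : RawGraph
    lab : Fin (suc k) → Maybe ℕ   -- vertex carrying label u (if any)
    nV nE : ℕ                     -- fresh vertex / edge names
open LGraph

isLab : Maybe ℕ → ℕ → Bool
isLab (just x) v = does (x ≟ℕ v)
isLab nothing v = false

labelOf : ∀ {k} → (Fin (suc k) → Maybe ℕ) → ℕ → Maybe (Fin (suc k))
labelOf {k} l v = foldr (λ u r → if isLab (l u) v then just u else r) nothing (allFin (suc k))

joinRen : ∀ {k} → LGraph k → LGraph k → ℕ → ℕ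
joinRen B₁ B₂ v with labelOf (lab B₂) v
... | nothing = nV B₁ + v
... | just u with lab B₁ u
...   | just w = w
...   | nothing = nV B₁ + v

build : ∀ {k} → Term k → LGraph k
build Leaf = record { graph = mkGraph [] [] [] ; lab = λ _ → nothing ; nV = 0 ; nE = 0 }
build (IntroVertex u τ) =
  let B = build τ in
  record { graph = mkGraph (nV B ∷ V (graph B)) (E (graph B)) (ρ (graph B))
         ; lab = λ x → if does (x ≟F u) then just (nV B) else lab B x
         ; nV = suc (nV B) ; nE = nE B }
build (ForgetVertex u τ) =
  let B = build τ in
  record { graph = graph B
         ; lab = λ x → if does (x ≟F u) then nothing else lab B x
         ; nV = nV B ; nE = nE B }
build (IntroEdge u v τ) with build τ
... | B with lab B u | lab B v
...   | just a | just c =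
        record { graph = mkGraph (V (graph B)) (nE B ∷ E (graph B))
                                 ((nE B , a) ∷ (nE B , c) ∷ ρ (graph B))
               ; lab = lab B ; nV = nV B ; nE = suc (nE B) }
...   | _ | _ = B   -- unreachable for legal terms
build (Join τ τ') =
  let B₁ = build τ ; B₂ = build τ' ; r = joinRen B₁ B₂ in
  record { graph = mkGraph (V (graph B₁) ++ map r (V (graph B₂)))
                           (E (graph B₁) ++ map (nE B₁ +_) (E (graph B₂)))
                           (ρ (graph B₁) ++ map (λ p → (nE B₁ + proj₁ p , r (proj₂ p))) (ρ (graph B₂)))
         ; lab = lab B₁ ; nV = nV B₁ + nV B₂ ; nE = nE B₁ + nE B₂ }

G⟦_⟧ : ∀ {k} → Term k → RawGraph
G⟦ τ ⟧ = graph (build τ)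

-- DP-cores. Witnesses are bit strings; finite sets of witnesses are lists
-- read as sets.

BitString : Set
BitString = List Bool

WSet : Set
WSet = List BitString

infix 4 _≈ₛ_
_≈ₛ_ : WSet → WSet → Set
S ≈ₛ S' = ∀ w → (w ∈L S) ⇔ (w ∈L S')

record DPCoreAt (k : ℕ) : Set where
  field
    W : BitString → Bool
    Final : BitString → Bool
    Leafₖ : WSet
    IntroVertexₖ ForgetVertexₖ : Fin (suc k) → BitString → WSet
    IntroEdgeₖ : Fin (suc k) → Fin (suc k) → BitString → WSet
    Joinₖ : BitString → BitString → WSet
    Cleanₖ : WSet → WSet
    Lbl : BitString → Subset (suc k)
    Leafₖ-W : All (λ w → T (W w)) Leafₖ
    IntroVertexₖ-W : ∀ u w → T (W w) → All (λ x → T (W x)) (IntroVertexₖ u w)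
    ForgetVertexₖ-W : ∀ u w → T (W w) → All (λ x → T (W x)) (ForgetVertexₖ u w)
    IntroEdgeₖ-W : ∀ u v → u ≢ v → ∀ w → T (W w) → All (λ x → T (W x)) (IntroEdgeₖ u v w)
    Joinₖ-W : ∀ w w' → T (W w) → T (W w') → All (λ x → T (W x)) (Joinₖ w w')
    Cleanₖ-W : ∀ S → All (λ x → T (W x)) S → All (λ x → T (W x)) (Cleanₖ S)
    -- Cleanₖ is a function of finite *sets*
    Cleanₖ-set : ∀ S S' → All (λ x → T (W x)) S → All (λ x → T (W x)) S' →
      S ≈ₛ S' → Cleanₖ S ≈ₛ Cleanₖ S'

DPCore : Set
DPCore = (k : ℕ) → DPCoreAt k

module _ {k : ℕ} (D : DPCoreAt k) where
  open DPCoreAt D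

  InW : WSet → Set
  InW S = All (λ x → T (W x)) S

  liftIV liftFV : Fin (suc k) → WSet → WSet
  liftIV u S = concatMap (IntroVertexₖ u) S
  liftFV u S = concatMap (ForgetVertexₖ u) S

  liftIE : Fin (suc k) → Fin (suc k) → WSet → WSet
  liftIE u v S = concatMap (IntroEdgeₖ u v) S

  liftJ : WSet → WSet → WSet
  liftJ S S' = concatMap (λ w → concatMap (Joinₖ w) S') S

  Dyn : Term k → WSet
  Dyn Term.Leaf = Leafₖ
  Dyn (Term.IntroVertex u τ) = Cleanₖ (liftIV u (Dyn τ))
  Dyn (Term.ForgetVertex u τ) = Cleanₖ (liftFV u (Dyn τ))
  Dyn (Term.IntroEdge u v τ) = Cleanₖ (liftIE u v (Dyn τ))
  Dyn (Term.Join τ τ') = Cleanₖ (liftJ (Dyn τ) (Dyn τ'))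

  Accepts : Term k → Set
  Accepts τ = Any (λ w → T (Final w)) (Dyn τ)

  LblIn : WSet → Subset (suc k) → Set
  LblIn S b = All (λ w → Lbl w ⊆ b) S

  record InterfaceRespecting : Set where
    field
      leaf : LblIn Leafₖ ∅
      introVertex : ∀ S b u → InW S → LblIn S b → u ∉ b → LblIn (liftIV u S) (b ∪ ⁅ u ⁆)
      forgetVertex : ∀ S b u → InW S → LblIn S b → u ∈ b → LblIn (liftFV u S) (b ─ ⁅ u ⁆)
      introEdge : ∀ S b u v → InW S → LblIn S b → u ≢ v → u ∈ b → v ∈ b → LblIn (liftIE u v S) b
      join : ∀ S S' b → InW S → InW S' → LblIn S b → LblIn S' b → LblIn (liftJ S S') b
      clean : ∀ S b → InW S → LblIn S b → LblIn (Cleanₖ S) b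

  PMap : Set
  PMap = Fin (suc k) → Maybe (Fin (suc k))

  InjectivePMap : PMap → Set
  InjectivePMap f = ∀ x y z → f x ≡ just z → f y ≡ just z → x ≡ y

  _⊆dom_ : Subset (suc k) → PMap → Set
  s ⊆dom f = ∀ {x} → x ∈ s → ∃ λ y → f x ≡ just y

  _∘ₚ_ : PMap → PMap → PMap
  (f ∘ₚ f') x = f' x >>= f

  -- ρ is given as a total map, of which only the values with
  -- Lbl w ⊆ dom f are meaningful (it is "defined" exactly there)
  record WitnessAction : Set where
    field
      act : PMap → BitString → BitString
      act-W : ∀ f w → InjectivePMap f → T (W w) → Lbl w ⊆dom f → T (W (act f w))
      act-Final : ∀ f w → InjectivePMap f → T (W w) → Lbl w ⊆dom f → Final (act f w) ≡ Final w
      act-Lbl : ∀ f w → InjectivePMap f → T (W w) → Lbl w ⊆dom f →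
        ∀ y → (y ∈ Lbl (act f w)) ⇔ (∃ λ x → (x ∈ Lbl w) × (f x ≡ just y))
      act-inv : ∀ f g w → InjectivePMap f → InjectivePMap g →
        (∀ x y → (f x ≡ just y) ⇔ (g y ≡ just x)) →
        T (W w) → Lbl w ⊆dom f → act g (act f w) ≡ w
      act-comp : ∀ f f' w → InjectivePMap f → InjectivePMap f' → T (W w) →
        Lbl w ⊆dom (f ∘ₚ f') → act (f ∘ₚ f') w ≡ act f (act f' w)
      act-ext : ∀ f f' w → InjectivePMap f → InjectivePMap f' →
        (∀ x y → f x ≡ just y → f' x ≡ just y) →
        T (W w) → Lbl w ⊆dom f → act f' w ≡ act f w
      comm-leaf : ∀ f → InjectivePMap f → map (act f) Leafₖ ≈ₛ Leafₖ
      comm-introVertex : ∀ f b w u u' → InjectivePMap f → b ⊆dom f → T (W w) → Lbl w ⊆ b →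
        u ∉ b → f u ≡ just u' →
        map (act f) (IntroVertexₖ u w) ≈ₛ IntroVertexₖ u' (act f w)
      comm-forgetVertex : ∀ f b w u u' → InjectivePMap f → b ⊆dom f → T (W w) → Lbl w ⊆ b →
        u ∈ b → f u ≡ just u' →
        map (act f) (ForgetVertexₖ u w) ≈ₛ ForgetVertexₖ u' (act f w)
      comm-introEdge : ∀ f b w u v u' v' → InjectivePMap f → b ⊆dom f → T (W w) → Lbl w ⊆ b →
        u ≢ v → u ∈ b → v ∈ b → f u ≡ just u' → f v ≡ just v' →
        map (act f) (IntroEdgeₖ u v w) ≈ₛ IntroEdgeₖ u' v' (act f w)
      comm-join : ∀ f b w w' → InjectivePMap f → b ⊆dom f → T (W w) → T (W w') →
        Lbl w ⊆ b → Lbl w' ⊆ b →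
        map (act f) (Joinₖ w w') ≈ₛ Joinₖ (act f w) (act f w')
      comm-clean : ∀ f b S → InjectivePMap f → b ⊆dom f → InW S → LblIn S b →
        map (act f) (Cleanₖ S) ≈ₛ Cleanₖ (map (act f) S)

open InterfaceRespecting public
open WitnessAction public

InP : DPCore → RawGraph → Set
InP D G = ∃ λ k → ∃ λ (b : Bag k) → ∃ λ (τ : Term k) →
  Legal b τ × Accepts (D k) τ × (G⟦ τ ⟧ ≅ G)

Finite : DPCore → Set
Finite D = ∀ k → ∃ λ (L : WSet) → ∀ w → T (DPCoreAt.W (D k) w) → w ∈L L

BitLength : DPCore → (ℕ → ℕ) → ℕ → ℕ → Set
BitLength D g C N = ∀ k → N ≤ k → ∀ w → T (DPCoreAt.W (D k) w) → length w ≤ C * g k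

Coherent : DPCore → Set
Coherent D = ∀ k k' (b : Bag k) (b' : Bag k') (τ : Term k) (τ' : Term k') →
  Legal b τ → Legal b' τ' → G⟦ τ ⟧ ≅ G⟦ τ' ⟧ → (Accepts (D k) τ ⇔ Accepts (D k') τ')

record GoodCore (D : DPCore) : Set where
  field
    finite : Finite D
    interface : ∀ k → InterfaceRespecting (D k)
    actions : ∀ k → WitnessAction (D k)

{-# OPTIONS --safe #-}

-- All four properties have the form: some colouring of the vertices with
-- finitely many colours has prescribed numbers of heavy vertices and of heavy
-- edges, where heaviness depends only on the colours. For maximum degree ≥ d
-- select one vertex and count the edges meeting it; for a clique select ω
-- vertices and count the edges inside them, which in a simple graph number at
-- most ω(ω-1)/2 with equality only for a clique; for a multiple edge select two
-- vertices and ask for two edges inside; for r-colourability ask for no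
-- monochromatic edge. One core therefore suffices: it guesses the colours and
-- remembers those of the bag together with two capped counters.
module Submission where

open import Defs
open import Data.Bool using (Bool; true; false; T; if_then_else_; _∧_; _∨_)
import Data.Bool.Properties as Bool
open import Data.Bool.Properties using (∧-comm; ∨-comm; T-∧; T-∨)
open import Data.Empty using (⊥; ⊥-elim)
open import Data.Fin using (Fin; zero; suc; toℕ; fromℕ<; inject≤; remQuot; combine)
open import Data.Fin.Properties using (any?; toℕ-fromℕ<; toℕ-injective; inject≤-injective; combine-remQuot) renaming (_≟_ to _≟F_)
open import Data.Fin.Subset using (Subset; inside; outside; _∈_; _∉_; _⊆_; _∪_; ⁅_⁆) renaming (⊥ to ∅; _─_ to _∖_)
open import Data.Fin.Subset.Properties using (x∈⁅x⁆; x∈p∪q⁺; x∈p∧x∉q⇒x∈p─q; x≢y⇒x∉⁅y⁆)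
open import Data.List using (List; []; _∷_; [_]; _++_; map; filter; filterᵇ; length; take; drop; foldr; concatMap; mapMaybe; fromMaybe; deduplicate; allFin)
open import Data.List.Membership.DecPropositional using () renaming (_∈?_ to ∈?-with)
open import Data.List.Membership.Propositional using (find; lose) renaming (_∈_ to _∈L_)
open import Data.List.Membership.Propositional.Properties using (∈-map⁺; ∈-map⁻; ∈-filter⁺; ∈-filter⁻; ∈-++⁺ˡ; ∈-++⁺ʳ; ∈-++⁻; ∈-concatMap⁺; ∈-concatMap⁻; ∈-allFin; ∈-deduplicate⁺; ∈-deduplicate⁻)
open import Data.List.Properties using (≡-dec; ∷-injective; length-++; length-map; map-++; map-∘; map-cong; take++drop≡id; concatMap-++; concatMap-map; map-concatMap)
open import Data.List.Relation.Unary.All using (All; []; _∷_)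
import Data.List.Relation.Unary.All as All
import Data.List.Relation.Unary.All.Properties as All
open import Data.List.Relation.Unary.AllPairs using ([]; _∷_)
import Data.List.Relation.Unary.AllPairs.Properties as AllPairs
open import Data.List.Relation.Unary.Any using (Any; here; there; _─_)
import Data.List.Relation.Unary.Any as Any
import Data.List.Relation.Unary.Unique.DecPropositional.Properties as DecUnique
open import Data.List.Relation.Unary.Unique.Propositional using (Unique)
import Data.List.Relation.Unary.Unique.Propositional.Properties as Unique
open import Data.Maybe using (Maybe; just; nothing; maybe′; is-just; _>>=_)
import Data.Maybe as Maybe
open import Data.Maybe.Properties using (just-injective) renaming (≡-dec to Maybe-≡-dec)
open import Data.Nat using (ℕ; zero; suc; _+_; _*_; _^_; _∸_; _⊓_; _⊔_; _≤_; _<_; _≟_; _≡ᵇ_; _≤ᵇ_; z≤n; s≤s; ⌈_/2⌉)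
open import Data.Nat.Induction using (<-wellFounded; Acc; acc)
open import Data.Nat.ListAction using (sum)
open import Data.Nat.Logarithm using (⌈log₂_⌉; ⌈log₂⌈n/2⌉⌉≡⌈log₂n⌉∸1; ⌈log₂⌉-mono-≤)
open import Data.Nat.Properties hiding (_≟_)
open import Data.Nat.Tactic.RingSolver using (solve-∀)
open import Data.Product using (∃; ∃₂; _×_; _,_; proj₁; proj₂)
open import Data.Sum using (_⊎_; inj₁; inj₂)
open import Data.Unit using (tt)
open import Data.Vec using (Vec; []; _∷_; lookup; tabulate; _[_]≔_; replicate)
import Data.Vec as Vec
open import Data.Vec.Properties using (lookup∘tabulate; tabulate∘lookup; tabulate-cong; lookup-map; lookup∘update; lookup∘update′; lookup-replicate; []=⇒lookup; lookup⇒[]=) renaming (≡-dec to Vec-≡-dec)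
open import Function using (_∘_; id; Equivalence)
open import Relation.Binary.PropositionalEquality using (_≡_; _≢_; refl; sym; trans; cong; cong₂; subst; module ≡-Reasoning)
open import Relation.Nullary using (¬_; Dec; yes; no; does; ¬?; _×-dec_; _⊎-dec_)
open import Relation.Nullary.Decidable using (map′; ⌊_⌋; toWitness; fromWitness; dec-true; dec-false)
open import Relation.Unary using (Decidable)

-- Counting in lists

length-─ : ∀ {A : Set} {x : A} {xs} (p : x ∈L xs) → suc (length (xs ─ p)) ≡ length xs
length-─ (here _) = refl
length-─ (there p) = cong suc (length-─ p)

∈-─ : ∀ {A : Set} {x y : A} {xs} (p : x ∈L xs) → y ∈L xs → y ≢ x → y ∈L (xs ─ p)
∈-─ (here refl) (here refl) y≢x = ⊥-elim (y≢x refl)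
∈-─ (here refl) (there q) y≢x = q
∈-─ (there p) (here refl) y≢x = here refl
∈-─ (there p) (there q) y≢x = there (∈-─ p q y≢x)

injection⇒length≤ : ∀ {A B : Set} (R : A → B → Set) xs ys → Unique xs →
  (∀ {x} → x ∈L xs → ∃ λ y → y ∈L ys × R x y) →
  (∀ {x x' y} → x ∈L xs → x' ∈L xs → R x y → R x' y → x ≡ x') →
  length xs ≤ length ys
injection⇒length≤ R [] ys _ _ _ = z≤n
injection⇒length≤ R (x ∷ xs) ys (x∉xs ∷ uxs) tot inj with tot (here refl)
... | y , y∈ys , Rxy = subst (suc (length xs) ≤_) (length-─ y∈ys)
  (s≤s (injection⇒length≤ R xs (ys ─ y∈ys) uxs tot' (λ p q → inj (there p) (there q))))
  where
  tot' : ∀ {x'} → x' ∈L xs → ∃ λ y' → y' ∈L (ys ─ y∈ys) × R x' y'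
  tot' {x'} p with tot (there p)
  ... | y' , y'∈ys , Rx'y' = y' , ∈-─ y∈ys y'∈ys y'≢y , Rx'y'
    where
    y'≢y : y' ≢ y
    y'≢y refl = All.lookup x∉xs p (inj (here refl) (there p) Rxy Rx'y')

bijection⇒length≡ : ∀ {A B : Set} (R : A → B → Set) xs ys → Unique xs → Unique ys →
  (∀ {x} → x ∈L xs → ∃ λ y → y ∈L ys × R x y) →
  (∀ {y} → y ∈L ys → ∃ λ x → x ∈L xs × R x y) →
  (∀ {x x' y} → R x y → R x' y → x ≡ x') →
  (∀ {x y y'} → R x y → R x y' → y ≡ y') →
  length xs ≡ length ys
bijection⇒length≡ R xs ys uxs uys t t' i i' = ≤-antisym
  (injection⇒length≤ R xs ys uxs t (λ _ _ → i))
  (injection⇒length≤ (λ y x → R x y) ys xs uys t' (λ _ _ → i'))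

⊆⇒length≤ : ∀ {A : Set} {xs ys : List A} → Unique xs → (∀ {x} → x ∈L xs → x ∈L ys) →
  length xs ≤ length ys
⊆⇒length≤ {xs = xs} {ys} u sub =
  injection⇒length≤ _≡_ xs ys u (λ p → _ , sub p , refl) (λ { _ _ refl refl → refl })

≐⇒length≡ : ∀ {A : Set} {xs ys : List A} {P : A → Set} → Unique xs → Unique ys →
  (∀ x → x ∈L xs ⇔ P x) → (∀ x → x ∈L ys ⇔ P x) → length xs ≡ length ys
≐⇒length≡ u u' m m' = ≤-antisym
  (⊆⇒length≤ u (λ {x} p → proj₂ (m' x) (proj₁ (m x) p)))
  (⊆⇒length≤ u' (λ {x} p → proj₂ (m x) (proj₁ (m' x) p)))

Unique-map : ∀ {A B : Set} {f : A → B} {xs} →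
  (∀ {x y} → x ∈L xs → y ∈L xs → f x ≡ f y → x ≡ y) → Unique xs → Unique (map f xs)
Unique-map inj [] = []
Unique-map {f = f} {x ∷ xs} inj (x∉ ∷ u) =
  All.tabulate fresh ∷ Unique-map (λ p q → inj (there p) (there q)) u
  where
  fresh : ∀ {y} → y ∈L map f xs → f x ≢ y
  fresh p eq with ∈-map⁻ f p
  ... | x' , x'∈ , refl = All.lookup x∉ x'∈ (inj (here refl) (there x'∈) eq)

bit : Bool → ℕ
bit true = 1
bit false = 0

count : ∀ {A : Set} → (A → Bool) → List A → ℕ
count p xs = sum (map (bit ∘ p) xs)

count-++ : ∀ {A : Set} (p : A → Bool) xs ys → count p (xs ++ ys) ≡ count p xs + count p ys
count-++ p [] ys = refl
count-++ p (x ∷ xs) ys =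
  trans (cong (bit (p x) +_) (count-++ p xs ys)) (sym (+-assoc (bit (p x)) _ _))

count-map : ∀ {A B : Set} (p : B → Bool) (f : A → B) xs → count p (map f xs) ≡ count (p ∘ f) xs
count-map p f xs = cong sum (sym (map-∘ xs))

count-cong : ∀ {A : Set} {p q : A → Bool} xs → (∀ {x} → x ∈L xs → p x ≡ q x) →
  count p xs ≡ count q xs
count-cong [] eq = refl
count-cong (x ∷ xs) eq = cong₂ _+_ (cong bit (eq (here refl))) (count-cong xs (eq ∘ there))

length-filterᵇ : ∀ {A : Set} (p : A → Bool) xs → length (filterᵇ p xs) ≡ count p xs
length-filterᵇ p [] = refl
length-filterᵇ p (x ∷ xs) with p x
... | true = cong suc (length-filterᵇ p xs)
... | false = length-filterᵇ p xs

⊓-+-⊓ : ∀ c x y → (x ⊓ c + y) ⊓ c ≡ (x + y) ⊓ c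
⊓-+-⊓ c x y with ≤-total x c
... | inj₁ x≤c rewrite m≤n⇒m⊓n≡m x≤c = refl
... | inj₂ c≤x rewrite m≥n⇒m⊓n≡n c≤x =
  trans (m≥n⇒m⊓n≡n (m≤m+n c y)) (sym (m≥n⇒m⊓n≡n (≤-trans c≤x (m≤m+n x y))))

-- Fixed-length binary codes

record Code (A : Set) (n : ℕ) : Set where
  field
    enc : A → BitString
    enc-length : ∀ a → length (enc a) ≡ n
    enc-injective : ∀ {a b} → enc a ≡ enc b → a ≡ b
    image? : ∀ w → Dec (∃ λ a → enc a ≡ w)

++-injective : ∀ {A : Set} (xs ys : List A) {zs ws} → length xs ≡ length ys →
  xs ++ zs ≡ ys ++ ws → xs ≡ ys × zs ≡ ws
++-injective [] [] _ eq = refl , eq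
++-injective (x ∷ xs) (y ∷ ys) l eq with ∷-injective eq
... | refl , eq' with ++-injective xs ys (suc-injective l) eq'
... | refl , eq'' = refl , eq''

bitOf : Fin 2 → Bool
bitOf zero = false
bitOf (suc zero) = true

bitOf-injective : ∀ i j → bitOf i ≡ bitOf j → i ≡ j
bitOf-injective zero zero _ = refl
bitOf-injective zero (suc zero) ()
bitOf-injective (suc zero) (suc zero) _ = refl

binary : ∀ n → Fin (2 ^ n) → BitString
binary zero _ = []
binary (suc n) i = bitOf (proj₁ (remQuot {2} (2 ^ n) i)) ∷ binary n (proj₂ (remQuot {2} (2 ^ n) i))

length-binary : ∀ n i → length (binary n i) ≡ n
length-binary zero i = refl
length-binary (suc n) i = cong suc (length-binary n _)

binary-injective : ∀ n i j → binary n i ≡ binary n j → i ≡ j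
binary-injective zero zero zero _ = refl
binary-injective (suc n) i j eq with ∷-injective eq
... | eq₁ , eq₂ = trans (sym (combine-remQuot {2} (2 ^ n) i))
  (trans (cong₂ combine (bitOf-injective _ _ eq₁) (binary-injective n _ _ eq₂))
         (combine-remQuot {2} (2 ^ n) j))

finCode : ∀ {m} n → m ≤ 2 ^ n → Code (Fin m) n
finCode {m} n m≤2^n = record
  { enc = enc
  ; enc-length = λ i → length-binary n _
  ; enc-injective = λ eq → inject≤-injective m≤2^n m≤2^n _ _ (binary-injective n _ _ eq)
  ; image? = λ w → any? (λ i → ≡-dec Bool._≟_ (enc i) w)
  }
  where
  enc : Fin m → BitString
  enc i = binary n (inject≤ i m≤2^n)

maybeCode : ∀ {m n} → Code (Fin (suc m)) n → Code (Maybe (Fin m)) n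
maybeCode {m} C = record
  { enc = enc ∘ to
  ; enc-length = enc-length ∘ to
  ; enc-injective = λ eq → to-injective _ _ (enc-injective eq)
  ; image? = λ w → map′ (λ (i , eq) → from i , trans (cong enc (to-from i)) eq)
                        (λ (x , eq) → to x , eq) (image? w)
  }
  where
  open Code C
  to : Maybe (Fin m) → Fin (suc m)
  to nothing = zero
  to (just i) = suc i
  from : Fin (suc m) → Maybe (Fin m)
  from zero = nothing
  from (suc i) = just i
  to-from : ∀ i → to (from i) ≡ i
  to-from zero = refl
  to-from (suc i) = refl
  to-injective : ∀ x y → to x ≡ to y → x ≡ y
  to-injective nothing nothing _ = refl
  to-injective (just i) (just .i) refl = refl

_×-code_ : ∀ {A B m n} → Code A m → Code B n → Code (A × B) (m + n)
_×-code_ {A} {B} {m} C D = record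
  { enc = enc
  ; enc-length = λ (a , b) →
      trans (length-++ (C.enc a)) (cong₂ _+_ (C.enc-length a) (D.enc-length b))
  ; enc-injective = injective
  ; image? = λ w → map′ (glue w) (split w) (C.image? (take m w) ×-dec D.image? (drop m w))
  }
  where
  module C = Code C
  module D = Code D
  enc : A × B → BitString
  enc (a , b) = C.enc a ++ D.enc b
  injective : ∀ {p q} → enc p ≡ enc q → p ≡ q
  injective {a , b} {a' , b'} eq
    with ++-injective (C.enc a) (C.enc a') (trans (C.enc-length a) (sym (C.enc-length a'))) eq
  ... | eq₁ , eq₂ = cong₂ _,_ (C.enc-injective eq₁) (D.enc-injective eq₂)
  glue : ∀ w → (∃ λ a → C.enc a ≡ take m w) × (∃ λ b → D.enc b ≡ drop m w) → ∃ λ p → enc p ≡ w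
  glue w ((a , eq) , (b , eq')) = (a , b) , trans (cong₂ _++_ eq eq') (take++drop≡id m w)
  take-drop : ∀ {k} (xs : BitString) {ys} → length xs ≡ k →
    xs ≡ take k (xs ++ ys) × ys ≡ drop k (xs ++ ys)
  take-drop [] refl = refl , refl
  take-drop (x ∷ xs) refl with take-drop xs refl
  ... | eq , eq' = cong (x ∷_) eq , eq'
  split : ∀ w → (∃ λ p → enc p ≡ w) → (∃ λ a → C.enc a ≡ take m w) × (∃ λ b → D.enc b ≡ drop m w)
  split w ((a , b) , refl) with take-drop (C.enc a) {D.enc b} (C.enc-length a)
  ... | eq , eq' = (a , eq) , (b , eq')

vecCode : ∀ {A n} → Code A n → ∀ m → Code (Vec A m) (m * n)
vecCode C zero = record
  { enc = λ _ → []
  ; enc-length = λ _ → refl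
  ; enc-injective = λ { {[]} {[]} _ → refl }
  ; image? = λ { [] → yes ([] , refl) ; (_ ∷ _) → no λ { (_ , ()) } }
  }
vecCode {A} C (suc m) = record
  { enc = enc ∘ uncons
  ; enc-length = enc-length ∘ uncons
  ; enc-injective = λ { {_ ∷ _} {_ ∷ _} eq → cong (λ (x , xs) → x ∷ xs) (enc-injective eq) }
  ; image? = λ w → map′ (λ { ((x , xs) , eq) → (x ∷ xs) , eq }) (λ (xs , eq) → uncons xs , eq) (image? w)
  }
  where
  open Code (C ×-code vecCode C m)
  uncons : Vec A (suc m) → A × Vec A m
  uncons (x ∷ xs) = x , xs

bitStrings : ℕ → WSet
bitStrings zero = [] ∷ []
bitStrings (suc n) = map (true ∷_) (bitStrings n) ++ map (false ∷_) (bitStrings n)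

∈-bitStrings : ∀ w → w ∈L bitStrings (length w)
∈-bitStrings [] = here refl
∈-bitStrings (true ∷ w) = ∈-++⁺ˡ (∈-map⁺ (true ∷_) (∈-bitStrings w))
∈-bitStrings (false ∷ w) =
  ∈-++⁺ʳ (map (true ∷_) (bitStrings (length w))) (∈-map⁺ (false ∷_) (∈-bitStrings w))

n≤⌈n/2⌉+⌈n/2⌉ : ∀ n → n ≤ ⌈ n /2⌉ + ⌈ n /2⌉
n≤⌈n/2⌉+⌈n/2⌉ n = subst (_≤ ⌈ n /2⌉ + ⌈ n /2⌉) (⌊n/2⌋+⌈n/2⌉≡n n) (+-monoˡ-≤ ⌈ n /2⌉ (⌊n/2⌋≤⌈n/2⌉ n))

1≤⌈log₂⌉ : ∀ {n} → 2 ≤ n → 1 ≤ ⌈log₂ n ⌉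
1≤⌈log₂⌉ = ⌈log₂⌉-mono-≤

n≤2^⌈log₂n⌉ : ∀ n → n ≤ 2 ^ ⌈log₂ n ⌉
n≤2^⌈log₂n⌉ n = go n (<-wellFounded n)
  where
  go : ∀ n → Acc _<_ n → n ≤ 2 ^ ⌈log₂ n ⌉
  go zero _ = z≤n
  go (suc zero) _ = ≤-refl
  go n@(suc (suc m)) (acc rec) = begin
    n ≤⟨ n≤⌈n/2⌉+⌈n/2⌉ n ⟩
    ⌈ n /2⌉ + ⌈ n /2⌉ ≡⟨ cong (⌈ n /2⌉ +_) (sym (+-identityʳ _)) ⟩
    2 * ⌈ n /2⌉ ≤⟨ *-monoʳ-≤ 2 (go ⌈ n /2⌉ (rec (⌈n/2⌉<n m))) ⟩
    2 ^ suc ⌈log₂ ⌈ n /2⌉ ⌉ ≡⟨ cong (λ l → 2 ^ suc l) (⌈log₂⌈n/2⌉⌉≡⌈log₂n⌉∸1 n) ⟩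
    2 ^ (1 + (⌈log₂ n ⌉ ∸ 1)) ≡⟨ cong (2 ^_) (m+[n∸m]≡n (1≤⌈log₂⌉ {n} (s≤s (s≤s z≤n)))) ⟩
    2 ^ ⌈log₂ n ⌉ ∎
    where open ≤-Reasoning

-- Capped counters

clip : ∀ c → ℕ → Fin (suc c)
clip c x = fromℕ< (s≤s (m⊓n≤n x c))

toℕ-clip : ∀ c x → toℕ (clip c x) ≡ x ⊓ c
toℕ-clip c x = toℕ-fromℕ< _

clip-+ : ∀ c x y → clip c (toℕ (clip c x) + y) ≡ clip c (x + y)
clip-+ c x y = toℕ-injective (begin
  toℕ (clip c (toℕ (clip c x) + y)) ≡⟨ toℕ-clip c _ ⟩
  (toℕ (clip c x) + y) ⊓ c ≡⟨ cong (λ z → (z + y) ⊓ c) (toℕ-clip c x) ⟩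
  (x ⊓ c + y) ⊓ c ≡⟨ ⊓-+-⊓ c x y ⟩
  (x + y) ⊓ c ≡⟨ toℕ-clip c _ ⟨
  toℕ (clip c (x + y)) ∎)
  where open ≡-Reasoning

clip-+-clip : ∀ c x y → clip c (toℕ (clip c x) + toℕ (clip c y)) ≡ clip c (x + y)
clip-+-clip c x y = begin
  clip c (toℕ (clip c x) + toℕ (clip c y)) ≡⟨ clip-+ c x _ ⟩
  clip c (x + toℕ (clip c y)) ≡⟨ cong (clip c) (+-comm x _) ⟩
  clip c (toℕ (clip c y) + x) ≡⟨ clip-+ c y x ⟩
  clip c (y + x) ≡⟨ cong (clip c) (+-comm y x) ⟩
  clip c (x + y) ∎
  where open ≡-Reasoning

-- Partial labellings of a bag and their relabelling

vec-ext : ∀ {A : Set} {n} {x y : Vec A n} → (∀ u → lookup x u ≡ lookup y u) → x ≡ y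
vec-ext {x = x} {y} eq = trans (sym (tabulate∘lookup x)) (trans (tabulate-cong eq) (tabulate∘lookup y))

maybe-ext : ∀ {A : Set} {x y : Maybe A} →
  (∀ {a} → x ≡ just a → y ≡ just a) → (∀ {a} → y ≡ just a → x ≡ just a) → x ≡ y
maybe-ext {x = just a} f g = sym (f refl)
maybe-ext {x = nothing} {just a} f g = g refl
maybe-ext {x = nothing} {nothing} f g = refl

module Relabelling {A : Set} {n : ℕ} where

  PartialMap : Set
  PartialMap = Fin n → Maybe (Fin n)

  Labelling : Set
  Labelling = Vec (Maybe A) n

  Inj : PartialMap → Set
  Inj f = ∀ x y z → f x ≡ just z → f y ≡ just z → x ≡ y

  dom : Labelling → Subset n
  dom = Vec.map is-just

  dom⁻ : ∀ x {u} → u ∈ dom x → ∃ λ a → lookup x u ≡ just a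
  dom⁻ x {u} p with lookup x u | trans (sym (lookup-map u is-just x)) ([]=⇒lookup p)
  ... | just a | _ = a , refl

  dom⁺ : ∀ x {u a} → lookup x u ≡ just a → u ∈ dom x
  dom⁺ x {u} eq = lookup⇒[]= u (dom x) (trans (lookup-map u is-just x) (cong is-just eq))

  preimage? : (f : PartialMap) (y : Fin n) → Dec (∃ λ z → f z ≡ just y)
  preimage? f y = any? (λ z → Maybe-≡-dec _≟F_ (f z) (just y))

  pull : PartialMap → Labelling → Fin n → Maybe A
  pull f x y with preimage? f y
  ... | yes (z , _) = lookup x z
  ... | no _ = nothing

  relabel : PartialMap → Labelling → Labelling
  relabel f x = tabulate (pull f x)

  relabel-image : ∀ f x {u y} → Inj f → f u ≡ just y → lookup (relabel f x) y ≡ lookup x u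
  relabel-image f x {u} {y} inj eq = trans (lookup∘tabulate (pull f x) y) helper
    where
    helper : pull f x y ≡ lookup x u
    helper with preimage? f y
    ... | yes (z , eq') = cong (lookup x) (inj z u y eq' eq)
    ... | no ¬p = ⊥-elim (¬p (u , eq))

  relabel-just⁺ : ∀ f x {u y a} → Inj f → f u ≡ just y → lookup x u ≡ just a →
    lookup (relabel f x) y ≡ just a
  relabel-just⁺ f x inj eq eq' = trans (relabel-image f x inj eq) eq'

  relabel-just⁻ : ∀ f x {y a} → lookup (relabel f x) y ≡ just a →
    ∃ λ u → f u ≡ just y × lookup x u ≡ just a
  relabel-just⁻ f x {y} eq with preimage? f y | trans (sym (lookup∘tabulate (pull f x) y)) eq
  ... | yes (z , fz) | eq' = z , fz , eq'

  labelling-ext : ∀ {x y : Labelling} →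
    (∀ u a → lookup x u ≡ just a → lookup y u ≡ just a) →
    (∀ u a → lookup y u ≡ just a → lookup x u ≡ just a) → x ≡ y
  labelling-ext f g = vec-ext (λ u → maybe-ext (f u _) (g u _))

  Defined : PartialMap → Labelling → Set
  Defined f x = ∀ {u} → u ∈ dom x → ∃ λ y → f u ≡ just y

  relabel-inverse : ∀ f g x → Inj f → Inj g → (∀ u y → (f u ≡ just y) ⇔ (g y ≡ just u)) →
    Defined f x → relabel g (relabel f x) ≡ x
  relabel-inverse f g x injf injg inv def = labelling-ext to from
    where
    to : ∀ u a → lookup (relabel g (relabel f x)) u ≡ just a → lookup x u ≡ just a
    to u a eq with relabel-just⁻ g (relabel f x) eq
    ... | y , gy , eq' = trans (sym (relabel-image f x injf (proj₂ (inv u y) gy))) eq'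
    from : ∀ u a → lookup x u ≡ just a → lookup (relabel g (relabel f x)) u ≡ just a
    from u a eq with def (dom⁺ x eq)
    ... | y , fu = relabel-just⁺ g _ injg (proj₁ (inv u y) fu) (relabel-just⁺ f x injf fu eq)

  relabel-compose : ∀ f f' x → Inj f → Inj f' →
    relabel (λ u → f' u >>= f) x ≡ relabel f (relabel f' x)
  relabel-compose f f' x injf injf' = labelling-ext to from
    where
    split : ∀ u {y} → (f' u >>= f) ≡ just y → ∃ λ z → f' u ≡ just z × f z ≡ just y
    split u eq with f' u
    ... | just z = z , refl , eq
    inj : Inj (λ u → f' u >>= f)
    inj u v y eq eq' with split u eq | split v eq'
    ... | z , e₁ , e₂ | z' , e₁' , e₂' = injf' u v z e₁ (trans e₁' (cong just (injf z' z y e₂' e₂)))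
    to : ∀ y a → lookup (relabel (λ u → f' u >>= f) x) y ≡ just a →
      lookup (relabel f (relabel f' x)) y ≡ just a
    to y a eq with relabel-just⁻ _ x eq
    ... | u , fu , xu with split u fu
    ... | z , f'u , fz = relabel-just⁺ f _ injf fz (relabel-just⁺ f' x injf' f'u xu)
    from : ∀ y a → lookup (relabel f (relabel f' x)) y ≡ just a →
      lookup (relabel (λ u → f' u >>= f) x) y ≡ just a
    from y a eq with relabel-just⁻ f _ eq
    ... | z , fz , eq' with relabel-just⁻ f' x eq'
    ... | u , f'u , xu = relabel-just⁺ _ x inj (trans (cong (_>>= f) f'u) fz) xu

  relabel-extend : ∀ f f' x → Inj f → Inj f' → (∀ u y → f u ≡ just y → f' u ≡ just y) →
    Defined f x → relabel f' x ≡ relabel f x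
  relabel-extend f f' x injf injf' ext def = labelling-ext to from
    where
    to : ∀ y a → lookup (relabel f' x) y ≡ just a → lookup (relabel f x) y ≡ just a
    to y a eq with relabel-just⁻ f' x eq
    ... | u , f'u , xu with def (dom⁺ x xu)
    ... | y' , fu with just-injective (trans (sym f'u) (ext u y' fu))
    ... | refl = relabel-just⁺ f x injf fu xu
    from : ∀ y a → lookup (relabel f x) y ≡ just a → lookup (relabel f' x) y ≡ just a
    from y a eq with relabel-just⁻ f x eq
    ... | u , fu , xu = relabel-just⁺ f' x injf' (ext u y fu) xu

  relabel-injective : ∀ f x y → Inj f → Defined f x → Defined f y →
    relabel f x ≡ relabel f y → x ≡ y
  relabel-injective f x y inj defx defy eq = labelling-ext (to x y defx eq) (to y x defy (sym eq))
    where
    to : ∀ x y → Defined f x → relabel f x ≡ relabel f y →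
      ∀ u a → lookup x u ≡ just a → lookup y u ≡ just a
    to x y def eq u a xu with def (dom⁺ x xu)
    ... | z , fu = trans (sym (relabel-image f y inj fu))
      (trans (cong (λ r → lookup r z) (sym eq)) (relabel-just⁺ f x inj fu xu))

  relabel-update : ∀ f x {u u'} m → Inj f → f u ≡ just u' →
    relabel f (x [ u ]≔ m) ≡ relabel f x [ u' ]≔ m
  relabel-update f x {u} {u'} m inj fu = vec-ext pointwise
    where
    pointwise : ∀ y → lookup (relabel f (x [ u ]≔ m)) y ≡ lookup (relabel f x [ u' ]≔ m) y
    pointwise y with y ≟F u'
    ... | yes refl = trans (relabel-image f _ inj fu)
      (trans (lookup∘update u x m) (sym (lookup∘update u' (relabel f x) m)))
    ... | no y≢u' = trans (maybe-ext to from) (sym (lookup∘update′ y≢u' (relabel f x) m))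
      where
      other : ∀ {z} → f z ≡ just y → lookup (x [ u ]≔ m) z ≡ lookup x z
      other fz = lookup∘update′ (λ { refl → y≢u' (just-injective (trans (sym fz) fu)) }) x m
      to : ∀ {a} → lookup (relabel f (x [ u ]≔ m)) y ≡ just a → lookup (relabel f x) y ≡ just a
      to eq with relabel-just⁻ f _ eq
      ... | z , fz , xz = relabel-just⁺ f x inj fz (trans (sym (other fz)) xz)
      from : ∀ {a} → lookup (relabel f x) y ≡ just a → lookup (relabel f (x [ u ]≔ m)) y ≡ just a
      from eq with relabel-just⁻ f x eq
      ... | z , fz , xz = relabel-just⁺ f _ inj fz (trans (other fz) xz)

  relabel-nothing : ∀ f → relabel f (replicate n nothing) ≡ replicate n nothing
  relabel-nothing f = labelling-ext to from
    where
    impossible : ∀ {C : Set} u {a : A} → lookup (replicate n nothing) u ≡ just a → C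
    impossible u eq with trans (sym (lookup-replicate u nothing)) eq
    ... | ()
    to : ∀ y a → lookup (relabel f (replicate n nothing)) y ≡ just a →
      lookup (replicate n nothing) y ≡ just a
    to y a eq with relabel-just⁻ f _ eq
    ... | u , _ , eq' = impossible u eq'
    from : ∀ y a → lookup (replicate n nothing) y ≡ just a →
      lookup (relabel f (replicate n nothing)) y ≡ just a
    from y a eq = impossible y eq

  weight : (A → Bool) → Labelling → ℕ
  weight w x = count (maybe′ w false ∘ lookup x) (allFin n)

  weight-relabel : ∀ w f x → Inj f → Defined f x → weight w (relabel f x) ≡ weight w x
  weight-relabel w f x inj def =
    trans (sym (length-filterᵇ p (allFin n))) (trans
      (bijection⇒length≡ R (filterᵇ p (allFin n)) (filterᵇ q (allFin n))
        (Unique.filter⁺ (Bool.T? ∘ p) (Unique.allFin⁺ n)) (Unique.filter⁺ (Bool.T? ∘ q) (Unique.allFin⁺ n))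
        total total' (λ r s → just-injective (trans (sym r) s)) (λ {y} {u} {u'} r s → inj u u' y r s))
      (length-filterᵇ q (allFin n)))
    where
    p q : Fin n → Bool
    p = maybe′ w false ∘ lookup (relabel f x)
    q = maybe′ w false ∘ lookup x
    R : Fin n → Fin n → Set
    R y u = f u ≡ just y
    nonempty : ∀ m → T (maybe′ w false m) → ∃ λ a → m ≡ just a
    nonempty (just a) _ = a , refl
    total : ∀ {y} → y ∈L filterᵇ p (allFin n) → ∃ λ u → u ∈L filterᵇ q (allFin n) × R y u
    total {y} y∈ with ∈-filter⁻ (Bool.T? ∘ p) {xs = allFin n} y∈
    ... | _ , py with nonempty (lookup (relabel f x) y) py
    ... | a , eq with relabel-just⁻ f x eq
    ... | u , fu , xu = u , ∈-filter⁺ (Bool.T? ∘ q) (∈-allFin u)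
      (subst (T ∘ maybe′ w false) (relabel-image f x inj fu) py) , fu
    total' : ∀ {u} → u ∈L filterᵇ q (allFin n) → ∃ λ y → y ∈L filterᵇ p (allFin n) × R y u
    total' {u} u∈ with ∈-filter⁻ (Bool.T? ∘ q) {xs = allFin n} u∈
    ... | _ , qu with nonempty (lookup x u) qu
    ... | a , xu with def (dom⁺ x xu)
    ... | y , fu = y , ∈-filter⁺ (Bool.T? ∘ p) (∈-allFin y)
      (subst (T ∘ maybe′ w false) (sym (relabel-image f x inj fu)) qu) , fu

-- The counting core

record Spec : Set where
  field
    colours capV capE : ℕ
    colour₀ : Fin colours
    wV : Fin colours → Bool
    wE : Fin colours → Fin colours → Bool
    wE-sym : ∀ a b → wE a b ≡ wE b a
    accept : ℕ → ℕ → Bool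
    bitsL bitsV bitsE : ℕ
    boundL : suc colours ≤ 2 ^ bitsL
    boundV : suc capV ≤ 2 ^ bitsV
    boundE : suc capE ≤ 2 ^ bitsE

module CountingCore (S : Spec) where
  open Spec S public

  Colour : Set
  Colour = Fin colours

  module At (k : ℕ) where
    open Relabelling {Colour} {suc k} public

    -- A vertex is counted when it is forgotten, so that Join merely adds the
    -- counters; the vertices still in the bag are added by the final test.
    State : Set
    State = Labelling × Fin (suc capV) × Fin (suc capE)

    abstract
      stateCode : Code State (suc k * bitsL + (bitsV + bitsE))
      stateCode = vecCode (maybeCode (finCode bitsL boundL)) (suc k)
        ×-code (finCode bitsV boundV ×-code finCode bitsE boundE)

    open Code stateCode public

    introVertexS : Fin (suc k) → Colour → State → State
    introVertexS u a (x , i , j) = x [ u ]≔ just a , i , j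

    introVerticesS : Fin (suc k) → State → List State
    introVerticesS u s = map (λ a → introVertexS u a s) (allFin colours)

    forgetWith : Fin (suc k) → State → Maybe Colour → List State
    forgetWith u (x , i , j) (just a) = [ x [ u ]≔ nothing , clip capV (toℕ i + bit (wV a)) , j ]
    forgetWith u s nothing = []

    forgetVertexS : Fin (suc k) → State → List State
    forgetVertexS u s = forgetWith u s (lookup (proj₁ s) u)

    edgeWith : State → Maybe Colour → Maybe Colour → List State
    edgeWith (x , i , j) (just a) (just b) = [ x , i , clip capE (toℕ j + bit (wE a b)) ]
    edgeWith s _ _ = []

    introEdgeS : Fin (suc k) → Fin (suc k) → State → List State
    introEdgeS u v s = edgeWith s (lookup (proj₁ s) u) (lookup (proj₁ s) v)

    joinWith : (s s' : State) → Dec (proj₁ s ≡ proj₁ s') → List State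
    joinWith (x , i , j) (_ , i' , j') (yes _) =
      [ x , clip capV (toℕ i + toℕ i') , clip capE (toℕ j + toℕ j') ]
    joinWith _ _ (no _) = []

    joinS : State → State → List State
    joinS s s' = joinWith s s' (Vec-≡-dec (Maybe-≡-dec _≟F_) (proj₁ s) (proj₁ s'))

    finalS : State → Bool
    finalS (x , i , j) = accept (toℕ (clip capV (toℕ i + weight wV x))) (toℕ j)

    actS : PartialMap → State → State
    actS f (x , ij) = relabel f x , ij

    leafS : State
    leafS = replicate (suc k) nothing , clip capV 0 , clip capE 0

    decodeWith : {B : Set} (d : B) (h : State → B) {w : BitString} → Dec (∃ λ s → enc s ≡ w) → B
    decodeWith d h (yes (s , _)) = h s
    decodeWith d h (no _) = d

    onCode : {B : Set} → B → (State → B) → BitString → B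
    onCode d h w = decodeWith d h (image? w)

    onCode-enc : {B : Set} (d : B) (h : State → B) (s : State) → onCode d h (enc s) ≡ h s
    onCode-enc d h s with image? (enc s)
    ... | yes (s' , eq) = cong h (enc-injective eq)
    ... | no ¬p = ⊥-elim (¬p (s , refl))

    valid : ∀ {w} → T ⌊ image? w ⌋ → ∃ λ s → enc s ≡ w
    valid {w} = toWitness {a? = image? w}

    valid-enc : ∀ s → T ⌊ image? (enc s) ⌋
    valid-enc s = fromWitness {a? = image? (enc s)} (s , refl)

    lift₁ : (State → List State) → BitString → WSet
    lift₁ h = onCode [] (map enc ∘ h)

    lift₂ : (State → State → List State) → BitString → BitString → WSet
    lift₂ h w w' = onCode [] (λ s → lift₁ (h s) w') w

    lift₁-enc : ∀ h s → lift₁ h (enc s) ≡ map enc (h s)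
    lift₁-enc h s = onCode-enc [] (map enc ∘ h) s

    lift₂-enc : ∀ h s s' → lift₂ h (enc s) (enc s') ≡ map enc (h s s')
    lift₂-enc h s s' = trans (onCode-enc [] (λ s → lift₁ (h s) (enc s')) s) (lift₁-enc (h s) s')

    all-valid : ∀ ss → All (λ w → T ⌊ image? w ⌋) (map enc ss)
    all-valid ss = All.map⁺ (All.tabulate (λ {s} _ → valid-enc s))

    lift₁-valid : ∀ h w → T ⌊ image? w ⌋ → All (λ w → T ⌊ image? w ⌋) (lift₁ h w)
    lift₁-valid h w v with valid v
    ... | s , refl = subst (All _) (sym (lift₁-enc h s)) (all-valid (h s))

    lift₂-valid : ∀ h w w' → T ⌊ image? w ⌋ → T ⌊ image? w' ⌋ → All (λ w → T ⌊ image? w ⌋) (lift₂ h w w')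
    lift₂-valid h w w' v v' with valid v | valid v'
    ... | s , refl | s' , refl = subst (All _) (sym (lift₂-enc h s s')) (all-valid (h s s'))

    label : BitString → Subset (suc k)
    label = onCode ∅ (dom ∘ proj₁)

    label-enc : ∀ s → label (enc s) ≡ dom (proj₁ s)
    label-enc = onCode-enc ∅ (dom ∘ proj₁)

    core : DPCoreAt k
    core = record
      { W = λ w → ⌊ image? w ⌋
      ; Final = onCode false finalS
      ; Leafₖ = [ enc leafS ]
      ; IntroVertexₖ = λ u → lift₁ (introVerticesS u)
      ; ForgetVertexₖ = λ u → lift₁ (forgetVertexS u)
      ; IntroEdgeₖ = λ u v → lift₁ (introEdgeS u v)
      ; Joinₖ = lift₂ joinS
      ; Cleanₖ = id
      ; Lbl = label
      ; Leafₖ-W = valid-enc leafS ∷ []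
      ; IntroVertexₖ-W = λ u → lift₁-valid (introVerticesS u)
      ; ForgetVertexₖ-W = λ u → lift₁-valid (forgetVertexS u)
      ; IntroEdgeₖ-W = λ u v _ → lift₁-valid (introEdgeS u v)
      ; Joinₖ-W = lift₂-valid joinS
      ; Cleanₖ-W = λ _ → id
      ; Cleanₖ-set = λ _ _ _ _ → id
      }

    _⊑_ : State → Subset (suc k) → Set
    s ⊑ b = dom (proj₁ s) ⊆ b

    All-concatMap : ∀ {P : BitString → Set} (g : BitString → WSet) S →
      (∀ {w} → w ∈L S → All P (g w)) → All P (concatMap g S)
    All-concatMap g S h = All.tabulate λ p → let _ , w∈S , q = find (∈-concatMap⁻ g {xs = S} p) in All.lookup (h w∈S) q

    all-labels : ∀ ss {b} → All (_⊑ b) ss → All (λ w → label w ⊆ b) (map enc ss)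
    all-labels ss = All.map⁺ ∘ All.map (λ {s} p {x} → p {x} ∘ subst (x ∈_) (label-enc s))

    lift₁-labels : ∀ h S b b' → All (λ w → T ⌊ image? w ⌋) S → All (λ w → label w ⊆ b) S →
      (∀ s → s ⊑ b → All (_⊑ b') (h s)) → All (λ w → label w ⊆ b') (concatMap (lift₁ h) S)
    lift₁-labels h S b b' vS lS step = All-concatMap (lift₁ h) S pointwise
      where
      pointwise : ∀ {w} → w ∈L S → All (λ w → label w ⊆ b') (lift₁ h w)
      pointwise w∈S with valid (All.lookup vS w∈S)
      ... | s , refl = subst (All _) (sym (lift₁-enc h s)) (all-labels (h s)
        (step s (λ {x} → All.lookup lS w∈S {x} ∘ subst (x ∈_) (sym (label-enc s)))))

    introVertex-labels : ∀ u b s → s ⊑ b → All (_⊑ (b ∪ ⁅ u ⁆)) (introVerticesS u s)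
    introVertex-labels u b (x , _) s⊑b = All.map⁺ (All.tabulate (λ {a} _ {y} → bound a y))
      where
      bound : ∀ a y → y ∈ dom (x [ u ]≔ just a) → y ∈ b ∪ ⁅ u ⁆
      bound a y y∈ with y ≟F u
      ... | yes refl = x∈p∪q⁺ (inj₂ (x∈⁅x⁆ u))
      ... | no y≢u = x∈p∪q⁺ (inj₁ (s⊑b (dom⁺ x
        (trans (sym (lookup∘update′ y≢u x _)) (proj₂ (dom⁻ (x [ u ]≔ just a) y∈))))))

    forgetVertex-labels : ∀ u b s → s ⊑ b → All (_⊑ (b ∖ ⁅ u ⁆)) (forgetVertexS u s)
    forgetVertex-labels u b (x , _) s⊑b with lookup x u
    ... | nothing = []
    ... | just _ = (λ {y} → bound y) ∷ []
      where
      bound : ∀ y → y ∈ dom (x [ u ]≔ nothing) → y ∈ b ∖ ⁅ u ⁆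
      bound y y∈ with dom⁻ (x [ u ]≔ nothing) y∈
      ... | a , eq with y ≟F u
      ...   | no y≢u = x∈p∧x∉q⇒x∈p─q
        (s⊑b (dom⁺ x (trans (sym (lookup∘update′ y≢u x _)) eq))) (x≢y⇒x∉⁅y⁆ y≢u)
      ...   | yes refl with trans (sym (lookup∘update u x nothing)) eq
      ...     | ()

    introEdge-labels : ∀ u v b s → s ⊑ b → All (_⊑ b) (introEdgeS u v s)
    introEdge-labels u v b (x , _) s⊑b with lookup x u | lookup x v
    ... | just _ | just _ = (λ {y} → s⊑b {y}) ∷ []
    ... | just _ | nothing = []
    ... | nothing | _ = []

    join-labels : ∀ b s s' → s ⊑ b → All (_⊑ b) (joinS s s')
    join-labels b (x , _) (x' , _) s⊑b with Vec-≡-dec (Maybe-≡-dec _≟F_) x x'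
    ... | yes _ = (λ {y} → s⊑b {y}) ∷ []
    ... | no _ = []

    leaf-labels : leafS ⊑ ∅
    leaf-labels {y} y∈ with dom⁻ (replicate (suc k) nothing) y∈
    ... | a , eq with trans (sym (lookup-replicate y nothing)) eq
    ... | ()

    interfaceRespecting : InterfaceRespecting core
    interfaceRespecting = record
      { leaf = all-labels [ leafS ] ((λ {y} → leaf-labels {y}) ∷ [])
      ; introVertex = λ S b u v l _ → lift₁-labels _ S b _ v l (introVertex-labels u b)
      ; forgetVertex = λ S b u v l _ → lift₁-labels _ S b _ v l (forgetVertex-labels u b)
      ; introEdge = λ S b u v vS l _ _ _ → lift₁-labels _ S b b vS l (introEdge-labels u v b)
      ; join = joinRespects
      ; clean = λ _ _ _ → id
      }
      where
      joinRespects : ∀ S S' b → InW core S → InW core S' → LblIn core S b → LblIn core S' b →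
        LblIn core (liftJ core S S') b
      joinRespects S S' b vS vS' lS lS' =
        All-concatMap _ S (λ w∈S → All-concatMap _ S' (pointwise w∈S))
        where
        pointwise : ∀ {w w'} → w ∈L S → w' ∈L S' → All (λ w → label w ⊆ b) (lift₂ joinS w w')
        pointwise w∈S w'∈S' with valid (All.lookup vS w∈S) | valid (All.lookup vS' w'∈S')
        ... | s , refl | s' , refl = subst (All _) (sym (lift₂-enc joinS s s')) (all-labels (joinS s s')
          (join-labels b s s' (λ {x} → All.lookup lS w∈S {x} ∘ subst (x ∈_) (sym (label-enc s)))))

    actW : PartialMap → BitString → BitString
    actW f = onCode [] (enc ∘ actS f)

    actW-enc : ∀ f s → actW f (enc s) ≡ enc (actS f s)
    actW-enc f = onCode-enc [] (enc ∘ actS f)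

    actW-map : ∀ f ss → map (actW f) (map enc ss) ≡ map enc (map (actS f) ss)
    actW-map f ss = trans (sym (map-∘ ss)) (trans (map-cong (actW-enc f) ss) (map-∘ ss))

    ≡⇒≈ₛ : ∀ {S S' : WSet} → S ≡ S' → S ≈ₛ S'
    ≡⇒≈ₛ refl w = id , id

    lift₁-equivariant : ∀ h h' f w → T ⌊ image? w ⌋ → (∀ s → map (actS f) (h s) ≡ h' (actS f s)) →
      map (actW f) (lift₁ h w) ≈ₛ lift₁ h' (actW f w)
    lift₁-equivariant h h' f w v eq with valid v
    ... | s , refl = ≡⇒≈ₛ (begin
      map (actW f) (lift₁ h (enc s)) ≡⟨ cong (map (actW f)) (lift₁-enc h s) ⟩
      map (actW f) (map enc (h s)) ≡⟨ actW-map f (h s) ⟩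
      map enc (map (actS f) (h s)) ≡⟨ cong (map enc) (eq s) ⟩
      map enc (h' (actS f s)) ≡⟨ lift₁-enc h' (actS f s) ⟨
      lift₁ h' (enc (actS f s)) ≡⟨ cong (lift₁ h') (actW-enc f s) ⟨
      lift₁ h' (actW f (enc s)) ∎)
      where open ≡-Reasoning

    introVertex-equivariant : ∀ f u u' → Inj f → f u ≡ just u' → ∀ s →
      map (actS f) (introVerticesS u s) ≡ introVerticesS u' (actS f s)
    introVertex-equivariant f u u' inj fu (x , ij) = trans (sym (map-∘ (allFin colours)))
      (map-cong (λ a → cong (_, ij) (relabel-update f x (just a) inj fu)) (allFin colours))

    forgetVertex-equivariant : ∀ f u u' → Inj f → f u ≡ just u' → ∀ s →
      map (actS f) (forgetVertexS u s) ≡ forgetVertexS u' (actS f s)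
    forgetVertex-equivariant f u u' inj fu (x , ij)
      rewrite relabel-image f x inj fu with lookup x u
    ... | nothing = refl
    ... | just _ = cong (λ y → [ y , _ ]) (relabel-update f x nothing inj fu)

    introEdge-equivariant : ∀ f u v u' v' → Inj f → f u ≡ just u' → f v ≡ just v' → ∀ s →
      map (actS f) (introEdgeS u v s) ≡ introEdgeS u' v' (actS f s)
    introEdge-equivariant f u v u' v' inj fu fv (x , ij)
      rewrite relabel-image f x inj fu | relabel-image f x inj fv with lookup x u | lookup x v
    ... | nothing | _ = refl
    ... | just _ | nothing = refl
    ... | just _ | just _ = refl

    join-equivariant : ∀ f s s' → Inj f → Defined f (proj₁ s) → Defined f (proj₁ s') →
      map (actS f) (joinS s s') ≡ joinS (actS f s) (actS f s')
    join-equivariant f (x , _) (x' , _) inj d d'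
      with Vec-≡-dec (Maybe-≡-dec _≟F_) x x' | Vec-≡-dec (Maybe-≡-dec _≟F_) (relabel f x) (relabel f x')
    ... | yes _ | yes _ = refl
    ... | no _ | no _ = refl
    ... | yes eq | no ¬eq = ⊥-elim (¬eq (cong (relabel f) eq))
    ... | no ¬eq | yes eq = ⊥-elim (¬eq (relabel-injective f x x' inj d d' eq))

    defined : ∀ f s → (∀ {u} → u ∈ label (enc s) → ∃ λ y → f u ≡ just y) → Defined f (proj₁ s)
    defined f s d {u} = d ∘ subst (u ∈_) (sym (label-enc s))

    witnessAction : WitnessAction core
    witnessAction = record
      { act = actW
      ; act-W = actValid
      ; act-Final = actFinal
      ; act-Lbl = actLabel
      ; act-inv = actInverse
      ; act-comp = actCompose
      ; act-ext = actExtend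
      ; comm-leaf = λ f _ → ≡⇒≈ₛ (trans (actW-map f [ leafS ])
          (cong (λ x → [ enc (x , proj₂ leafS) ]) (relabel-nothing f)))
      ; comm-introVertex = λ f b w u u' inj _ v _ _ fu →
          lift₁-equivariant _ _ f w v (introVertex-equivariant f u u' inj fu)
      ; comm-forgetVertex = λ f b w u u' inj _ v _ _ fu →
          lift₁-equivariant _ _ f w v (forgetVertex-equivariant f u u' inj fu)
      ; comm-introEdge = λ f b w u v u' v' inj _ vw _ _ _ _ fu fv →
          lift₁-equivariant _ _ f w vw (introEdge-equivariant f u v u' v' inj fu fv)
      ; comm-join = actJoin
      ; comm-clean = λ _ _ _ _ _ _ _ _ → id , id
      }
      where
      open DPCoreAt core using (W; Final)
      actValid : ∀ f w → Inj f → T (W w) → _⊆dom_ core (label w) f → T (W (actW f w))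
      actValid f w _ v _ with valid v
      ... | s , refl = subst (T ∘ W) (sym (actW-enc f s)) (valid-enc (actS f s))
      actFinal : ∀ f w → Inj f → T (W w) → _⊆dom_ core (label w) f → Final (actW f w) ≡ Final w
      actFinal f w inj v d with valid v
      ... | s@(x , i , j) , refl = begin
        Final (actW f (enc s)) ≡⟨ cong Final (actW-enc f s) ⟩
        Final (enc (actS f s)) ≡⟨ onCode-enc false finalS (actS f s) ⟩
        finalS (actS f s) ≡⟨ cong (λ z → accept (toℕ (clip capV (toℕ i + z))) (toℕ j))
                                  (weight-relabel wV f x inj (defined f s d)) ⟩
        finalS s ≡⟨ onCode-enc false finalS s ⟨
        Final (enc s) ∎
        where open ≡-Reasoning
      actLabel : ∀ f w → Inj f → T (W w) → _⊆dom_ core (label w) f →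
        ∀ y → (y ∈ label (actW f w)) ⇔ (∃ λ u → (u ∈ label w) × (f u ≡ just y))
      actLabel f w inj v d y with valid v
      ... | s@(x , _) , refl rewrite actW-enc f s | label-enc s | label-enc (actS f s) = to , from
        where
        to : y ∈ dom (relabel f x) → ∃ λ u → u ∈ dom x × f u ≡ just y
        to y∈ with dom⁻ (relabel f x) y∈
        ... | a , eq with relabel-just⁻ f x eq
        ... | u , fu , xu = u , dom⁺ x xu , fu
        from : (∃ λ u → u ∈ dom x × f u ≡ just y) → y ∈ dom (relabel f x)
        from (u , u∈ , fu) with dom⁻ x u∈
        ... | a , xu = dom⁺ (relabel f x) (relabel-just⁺ f x inj fu xu)
      actInverse : ∀ f g w → Inj f → Inj g → (∀ x y → (f x ≡ just y) ⇔ (g y ≡ just x)) →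
        T (W w) → _⊆dom_ core (label w) f → actW g (actW f w) ≡ w
      actInverse f g w injf injg inv v d with valid v
      ... | s@(x , ij) , refl = trans (cong (actW g) (actW-enc f s)) (trans (actW-enc g (actS f s))
        (cong (λ x → enc (x , ij)) (relabel-inverse f g x injf injg inv (defined f s d))))
      actCompose : ∀ f f' w → Inj f → Inj f' → T (W w) → _⊆dom_ core (label w) (_∘ₚ_ core f f') →
        actW (_∘ₚ_ core f f') w ≡ actW f (actW f' w)
      actCompose f f' w injf injf' v _ with valid v
      ... | s@(x , ij) , refl = trans (actW-enc (_∘ₚ_ core f f') s) (trans
        (cong (λ x → enc (x , ij)) (relabel-compose f f' x injf injf'))
        (sym (trans (cong (actW f) (actW-enc f' s)) (actW-enc f (actS f' s)))))
      actExtend : ∀ f f' w → Inj f → Inj f' → (∀ x y → f x ≡ just y → f' x ≡ just y) →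
        T (W w) → _⊆dom_ core (label w) f → actW f' w ≡ actW f w
      actExtend f f' w injf injf' ext v d with valid v
      ... | s@(x , ij) , refl = trans (actW-enc f' s) (trans
        (cong (λ x → enc (x , ij)) (relabel-extend f f' x injf injf' ext (defined f s d)))
        (sym (actW-enc f s)))
      actJoin : ∀ f b w w' → Inj f → _⊆dom_ core b f → T (W w) → T (W w') →
        label w ⊆ b → label w' ⊆ b →
        map (actW f) (lift₂ joinS w w') ≈ₛ lift₂ joinS (actW f w) (actW f w')
      actJoin f b w w' inj b⊆ v v' l l' with valid v | valid v'
      ... | s , refl | s' , refl = ≡⇒≈ₛ (begin
        map (actW f) (lift₂ joinS (enc s) (enc s')) ≡⟨ cong (map (actW f)) (lift₂-enc joinS s s') ⟩
        map (actW f) (map enc (joinS s s')) ≡⟨ actW-map f (joinS s s') ⟩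
        map enc (map (actS f) (joinS s s')) ≡⟨ cong (map enc) (join-equivariant f s s' inj
          (defined f s (λ p → b⊆ (l p))) (defined f s' (λ p → b⊆ (l' p)))) ⟩
        map enc (joinS (actS f s) (actS f s')) ≡⟨ lift₂-enc joinS (actS f s) (actS f s') ⟨
        lift₂ joinS (enc (actS f s)) (enc (actS f s')) ≡⟨ cong₂ (lift₂ joinS) (actW-enc f s) (actW-enc f s') ⟨
        lift₂ joinS (actW f (enc s)) (actW f (enc s')) ∎)
        where open ≡-Reasoning

  countingCore : DPCore
  countingCore = At.core

  witnessLength : ℕ → ℕ
  witnessLength k = suc k * bitsL + (bitsV + bitsE)

  length-witness : ∀ k w → T (DPCoreAt.W (countingCore k) w) → length w ≡ witnessLength k
  length-witness k w v with At.valid k v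
  ... | s , refl = At.enc-length k s

  goodCore : GoodCore countingCore
  goodCore = record
    { finite = λ k → bitStrings (witnessLength k) ,
        λ w v → subst (λ n → w ∈L bitStrings n) (length-witness k w v) (∈-bitStrings w)
    ; interface = At.interfaceRespecting
    ; actions = At.witnessAction
    }

-- The labelled graph of a legal term

open LGraph

isLab-sound : ∀ m v → isLab m v ≡ true → m ≡ just v
isLab-sound (just x) v eq = cong just (≡ᵇ⇒≡ x v (subst T (sym eq) tt))

isLab-complete : ∀ {m v} → m ≡ just v → isLab m v ≡ true
isLab-complete {v = v} refl = dec-true (v ≟ v) refl

labelOf-just : ∀ {k} (l : Fin (suc k) → Maybe ℕ) v {u} → labelOf l v ≡ just u → l u ≡ just v
labelOf-just {k} l v = go (allFin (suc k))
  where
  go : ∀ us {u} → foldr (λ u r → if isLab (l u) v then just u else r) nothing us ≡ just u →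
    l u ≡ just v
  go (u ∷ us) eq with isLab (l u) v in lu
  ... | false = go us eq
  ... | true with eq
  ...   | refl = isLab-sound (l u) v lu

labelOf-nothing : ∀ {k} (l : Fin (suc k) → Maybe ℕ) v → labelOf l v ≡ nothing → ∀ u → l u ≢ just v
labelOf-nothing {k} l v eq u = go (allFin (suc k)) eq (∈-allFin u)
  where
  go : ∀ us → foldr (λ u r → if isLab (l u) v then just u else r) nothing us ≡ nothing →
    ∀ {u} → u ∈L us → l u ≢ just v
  go (u ∷ us) eq p lu with isLab (l u) v in lu'
  go (u ∷ us) eq (here refl) lu | false with trans (sym lu') (isLab-complete lu)
  ... | ()
  go (u ∷ us) eq (there p) lu | false = go us eq p lu

joinRen-cases : ∀ {k} (B₁ B₂ : LGraph k) → (∀ {u v} → lab B₂ u ≡ just v → ∃ λ w → lab B₁ u ≡ just w) →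
  ∀ v → (∃₂ λ u w → lab B₂ u ≡ just v × lab B₁ u ≡ just w × joinRen B₁ B₂ v ≡ w)
      ⊎ ((∀ u → lab B₂ u ≢ just v) × joinRen B₁ B₂ v ≡ nV B₁ + v)
joinRen-cases B₁ B₂ sub v with labelOf (lab B₂) v in eq
... | nothing = inj₂ (labelOf-nothing (lab B₂) v eq , refl)
... | just u with lab B₁ u in eq₁
...   | just w = inj₁ (u , w , labelOf-just (lab B₂) v eq , eq₁ , refl)
...   | nothing with trans (sym eq₁) (proj₂ (sub (labelOf-just (lab B₂) v eq)))
...     | ()

Edge : Set
Edge = ℕ × ℕ × ℕ

newEdge : ℕ → Maybe ℕ → Maybe ℕ → List Edge
newEdge e (just x) (just y) = [ e , x , y ]
newEdge e _ _ = []

mapEdge : ℕ → (ℕ → ℕ) → Edge → Edge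
mapEdge n r (e , x , y) = n + e , r x , r y

incidences : Edge → List (ℕ × ℕ)
incidences (e , x , y) = (e , x) ∷ (e , y) ∷ []

forgotten : ∀ {k} → Term k → List ℕ
forgotten Leaf = []
forgotten (IntroVertex u τ) = forgotten τ
forgotten (ForgetVertex u τ) = fromMaybe (lab (build τ) u) ++ forgotten τ
forgotten (IntroEdge u v τ) = forgotten τ
forgotten (Join τ τ') = forgotten τ ++ map (joinRen (build τ) (build τ')) (forgotten τ')

edges : ∀ {k} → Term k → List Edge
edges Leaf = []
edges (IntroVertex u τ) = edges τ
edges (ForgetVertex u τ) = edges τ
edges (IntroEdge u v τ) = newEdge (nE (build τ)) (lab (build τ) u) (lab (build τ) v) ++ edges τ
edges (Join τ τ') = edges τ ++ map (mapEdge (nE (build τ)) (joinRen (build τ) (build τ'))) (edges τ')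

record Invariant {k} (b : Bag k) (B : LGraph k) (fs : List ℕ) (es : List Edge) : Set where
  field
    lab-∈ : ∀ {u} → u ∈ b → ∃ λ v → lab B u ≡ just v
    lab-dom : ∀ {u v} → lab B u ≡ just v → u ∈ b
    lab-injective : ∀ {u u' v} → lab B u ≡ just v → lab B u' ≡ just v → u ≡ u'
    lab-V : ∀ {u v} → lab B u ≡ just v → v ∈L V (graph B)
    V<nV : ∀ {v} → v ∈L V (graph B) → v < nV B
    V-cases : ∀ {v} → v ∈L V (graph B) → v ∈L fs ⊎ (∃ λ u → lab B u ≡ just v)
    forgotten-V : ∀ {v} → v ∈L fs → v ∈L V (graph B)
    forgotten-unlabelled : ∀ {v} → v ∈L fs → ∀ u → lab B u ≢ just v
    forgotten-unique : Unique fs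
    E≡ : E (graph B) ≡ map proj₁ es
    ρ≡ : ρ (graph B) ≡ concatMap incidences es
    edges-unique : Unique (map proj₁ es)
    edges<nE : ∀ {e x y} → (e , x , y) ∈L es → e < nE B
    edges-V : ∀ {e x y} → (e , x , y) ∈L es → x ∈L V (graph B) × y ∈L V (graph B) × x ≢ y

∈-update⁻ : ∀ {n} {x u : Fin n} {b : Subset n} {s} → x ≢ u → x ∈ b [ u ]≔ s → x ∈ b
∈-update⁻ {x = x} {b = b} x≢u p = lookup⇒[]= x b (trans (sym (lookup∘update′ x≢u b _)) ([]=⇒lookup p))

∈-update⁺ : ∀ {n} {x u : Fin n} {b : Subset n} {s} → x ≢ u → x ∈ b → x ∈ b [ u ]≔ s
∈-update⁺ {x = x} {b = b} x≢u p = lookup⇒[]= x _ (trans (lookup∘update′ x≢u b _) ([]=⇒lookup p))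

∈-update-inside : ∀ {n} (u : Fin n) (b : Subset n) → u ∈ b [ u ]≔ inside
∈-update-inside u b = lookup⇒[]= u _ (lookup∘update u b inside)

∉-update-outside : ∀ {n} (u : Fin n) (b : Subset n) → u ∉ b [ u ]≔ outside
∉-update-outside u b p with trans (sym (lookup∘update u b outside)) ([]=⇒lookup p)
... | ()

module IntroVertexInvariant {k} {b : Bag k} (τ : Term k) {fs es} (u : Fin (suc k)) (u∉b : u ∉ b)
  (I : Invariant b (build τ) fs es) where
  open Invariant I
  B B' : LGraph k
  B = build τ
  B' = build (IntroVertex u τ)

  lab-cases : ∀ {x v} → lab B' x ≡ just v → (x ≡ u × v ≡ nV B) ⊎ (x ≢ u × lab B x ≡ just v)
  lab-cases {x} eq with x ≟F u
  ... | yes p = inj₁ (p , sym (just-injective eq))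
  ... | no p = inj₂ (p , eq)

  lab-new : lab B' u ≡ just (nV B)
  lab-new with u ≟F u
  ... | yes _ = refl
  ... | no p = ⊥-elim (p refl)

  lab-old : ∀ {x} → x ≢ u → lab B' x ≡ lab B x
  lab-old {x} x≢u with x ≟F u
  ... | yes p = ⊥-elim (x≢u p)
  ... | no _ = refl

  nV∉V : ∀ {v} → v ∈L V (graph B) → v ≢ nV B
  nV∉V p refl = <-irrefl refl (V<nV p)

  lab-old-just : ∀ {x v} → lab B x ≡ just v → lab B' x ≡ just v
  lab-old-just eq = trans (lab-old (λ { refl → u∉b (lab-dom eq) })) eq

  invariant : Invariant (b [ u ]≔ inside) B' fs es
  invariant = record
    { lab-∈ = lab-∈'
    ; lab-dom = lab-dom'
    ; lab-injective = lab-injective'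
    ; lab-V = lab-V'
    ; V<nV = λ { (here refl) → n<1+n (nV B) ; (there p) → m<n⇒m<1+n (V<nV p) }
    ; V-cases = V-cases'
    ; forgotten-V = there ∘ forgotten-V
    ; forgotten-unlabelled = unlabelled'
    ; forgotten-unique = forgotten-unique
    ; E≡ = E≡
    ; ρ≡ = ρ≡
    ; edges-unique = edges-unique
    ; edges<nE = edges<nE
    ; edges-V = λ p → let x∈ , y∈ , x≢y = edges-V p in there x∈ , there y∈ , x≢y
    }
    where
    lab-∈' : ∀ {x} → x ∈ b [ u ]≔ inside → ∃ λ v → lab B' x ≡ just v
    lab-∈' {x} x∈ with x ≟F u
    ... | yes _ = nV B , refl
    ... | no x≢u = lab-∈ (∈-update⁻ x≢u x∈)
    lab-dom' : ∀ {x v} → lab B' x ≡ just v → x ∈ b [ u ]≔ inside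
    lab-dom' eq with lab-cases eq
    ... | inj₁ (refl , _) = ∈-update-inside u b
    ... | inj₂ (x≢u , eq') = ∈-update⁺ x≢u (lab-dom eq')
    lab-injective' : ∀ {x x' v} → lab B' x ≡ just v → lab B' x' ≡ just v → x ≡ x'
    lab-injective' eq eq' with lab-cases eq | lab-cases eq'
    ... | inj₁ (refl , _) | inj₁ (refl , _) = refl
    ... | inj₁ (_ , refl) | inj₂ (_ , q) = ⊥-elim (nV∉V (lab-V q) refl)
    ... | inj₂ (_ , q) | inj₁ (_ , refl) = ⊥-elim (nV∉V (lab-V q) refl)
    ... | inj₂ (_ , q) | inj₂ (_ , q') = lab-injective q q'
    lab-V' : ∀ {x v} → lab B' x ≡ just v → v ∈L V (graph B')
    lab-V' eq with lab-cases eq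
    ... | inj₁ (_ , refl) = here refl
    ... | inj₂ (_ , q) = there (lab-V q)
    V-cases' : ∀ {v} → v ∈L V (graph B') → v ∈L fs ⊎ (∃ λ x → lab B' x ≡ just v)
    V-cases' (here refl) = inj₂ (u , lab-new)
    V-cases' (there p) with V-cases p
    ... | inj₁ q = inj₁ q
    ... | inj₂ (x , q) = inj₂ (x , lab-old-just q)
    unlabelled' : ∀ {v} → v ∈L fs → ∀ x → lab B' x ≢ just v
    unlabelled' p x eq with lab-cases eq
    ... | inj₁ (_ , q) = nV∉V (forgotten-V p) q
    ... | inj₂ (_ , q) = forgotten-unlabelled p x q

module ForgetVertexInvariant {k} {b : Bag k} (τ : Term k) {fs es} (u : Fin (suc k)) (u∈b : u ∈ b)
  (I : Invariant b (build τ) fs es) where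
  open Invariant I
  B B' : LGraph k
  B = build τ
  B' = build (ForgetVertex u τ)

  a : ℕ
  a = proj₁ (lab-∈ u∈b)

  lab-u : lab B u ≡ just a
  lab-u = proj₂ (lab-∈ u∈b)

  lab-just : ∀ {x v} → lab B' x ≡ just v → x ≢ u × lab B x ≡ just v
  lab-just {x} eq with x ≟F u
  ... | no p = p , eq

  lab-other : ∀ {x} → x ≢ u → lab B' x ≡ lab B x
  lab-other {x} x≢u with x ≟F u
  ... | yes p = ⊥-elim (x≢u p)
  ... | no _ = refl

  lab-gone : lab B' u ≡ nothing
  lab-gone with u ≟F u
  ... | yes _ = refl
  ... | no p = ⊥-elim (p refl)

  invariant : Invariant (b [ u ]≔ outside) B' (fromMaybe (lab B u) ++ fs) es
  invariant = subst (λ m → Invariant (b [ u ]≔ outside) B' (fromMaybe m ++ fs) es) (sym lab-u) (record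
    { lab-∈ = lab-∈'
    ; lab-dom = λ eq → let x≢u , q = lab-just eq in ∈-update⁺ x≢u (lab-dom q)
    ; lab-injective = λ p q → lab-injective (proj₂ (lab-just p)) (proj₂ (lab-just q))
    ; lab-V = lab-V ∘ proj₂ ∘ lab-just
    ; V<nV = V<nV
    ; V-cases = V-cases'
    ; forgotten-V = λ { (here refl) → lab-V lab-u ; (there p) → forgotten-V p }
    ; forgotten-unlabelled = unlabelled'
    ; forgotten-unique = All.tabulate (λ { p refl → forgotten-unlabelled p u lab-u }) ∷ forgotten-unique
    ; E≡ = E≡
    ; ρ≡ = ρ≡
    ; edges-unique = edges-unique
    ; edges<nE = edges<nE
    ; edges-V = edges-V
    })
    where
    lab-∈' : ∀ {x} → x ∈ b [ u ]≔ outside → ∃ λ v → lab B' x ≡ just v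
    lab-∈' {x} x∈ with x ≟F u
    ... | yes refl = ⊥-elim (∉-update-outside u b x∈)
    ... | no x≢u = lab-∈ (∈-update⁻ x≢u x∈)
    V-cases' : ∀ {v} → v ∈L V (graph B) → v ∈L (a ∷ fs) ⊎ (∃ λ x → lab B' x ≡ just v)
    V-cases' p with V-cases p
    ... | inj₁ q = inj₁ (there q)
    ... | inj₂ (x , q) with x ≟F u
    ...   | yes refl = inj₁ (here (just-injective (trans (sym q) lab-u)))
    ...   | no x≢u = inj₂ (x , trans (lab-other x≢u) q)
    unlabelled' : ∀ {v} → v ∈L (a ∷ fs) → ∀ x → lab B' x ≢ just v
    unlabelled' (here refl) x eq = proj₁ (lab-just eq) (lab-injective (proj₂ (lab-just eq)) lab-u)
    unlabelled' (there p) x eq = forgotten-unlabelled p x (proj₂ (lab-just eq))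

addEdge : ∀ {k} → ℕ → ℕ → LGraph k → LGraph k
addEdge x y B = record
  { graph = mkGraph (V (graph B)) (nE B ∷ E (graph B)) ((nE B , x) ∷ (nE B , y) ∷ ρ (graph B))
  ; lab = lab B ; nV = nV B ; nE = suc (nE B) }

build-IntroEdge : ∀ {k} u v (τ : Term k) {x y} → lab (build τ) u ≡ just x → lab (build τ) v ≡ just y →
  build (IntroEdge u v τ) ≡ addEdge x y (build τ)
build-IntroEdge u v τ eq eq' rewrite eq | eq' = refl

addEdge-invariant : ∀ {k} {b : Bag k} {B fs es x y} → x ∈L V (graph B) → y ∈L V (graph B) → x ≢ y →
  Invariant b B fs es → Invariant b (addEdge x y B) fs ((nE B , x , y) ∷ es)
addEdge-invariant {B = B} {es = es} {x} {y} x∈ y∈ x≢y I = record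
  { lab-∈ = lab-∈
  ; lab-dom = lab-dom
  ; lab-injective = lab-injective
  ; lab-V = lab-V
  ; V<nV = V<nV
  ; V-cases = V-cases
  ; forgotten-V = forgotten-V
  ; forgotten-unlabelled = forgotten-unlabelled
  ; forgotten-unique = forgotten-unique
  ; E≡ = cong (nE B ∷_) E≡
  ; ρ≡ = cong (λ r → (nE B , x) ∷ (nE B , y) ∷ r) ρ≡
  ; edges-unique = All.tabulate fresh ∷ edges-unique
  ; edges<nE = λ { (here refl) → n<1+n (nE B) ; (there p) → m<n⇒m<1+n (edges<nE p) }
  ; edges-V = λ { (here refl) → x∈ , y∈ , x≢y ; (there p) → edges-V p }
  }
  where
  open Invariant I
  fresh : ∀ {e} → e ∈L map proj₁ es → nE B ≢ e
  fresh p refl with ∈-map⁻ proj₁ p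
  ... | _ , q , refl = <-irrefl refl (edges<nE q)

module JoinInvariant {k} {b : Bag k} (τ₁ τ₂ : Term k) {fs₁ fs₂ es₁ es₂}
  (I₁ : Invariant b (build τ₁) fs₁ es₁) (I₂ : Invariant b (build τ₂) fs₂ es₂) where
  module I₁ = Invariant I₁
  module I₂ = Invariant I₂
  B₁ B₂ B' : LGraph k
  B₁ = build τ₁
  B₂ = build τ₂
  B' = build (Join τ₁ τ₂)

  r : ℕ → ℕ
  r = joinRen B₁ B₂

  r-cases : ∀ v → (∃₂ λ u w → lab B₂ u ≡ just v × lab B₁ u ≡ just w × r v ≡ w)
                ⊎ ((∀ u → lab B₂ u ≢ just v) × r v ≡ nV B₁ + v)
  r-cases = joinRen-cases B₁ B₂ (λ eq → I₁.lab-∈ (I₂.lab-dom eq))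

  r-labelled : ∀ {u v w} → lab B₂ u ≡ just v → lab B₁ u ≡ just w → r v ≡ w
  r-labelled {u} {v} eq₂ eq₁ with r-cases v
  ... | inj₂ (none , _) = ⊥-elim (none u eq₂)
  ... | inj₁ (u' , w' , eq₂' , eq₁' , rv) with I₂.lab-injective eq₂ eq₂'
  ...   | refl = trans rv (just-injective (trans (sym eq₁') eq₁))

  r-unlabelled : ∀ {v} → (∀ u → lab B₂ u ≢ just v) → r v ≡ nV B₁ + v
  r-unlabelled {v} none with r-cases v
  ... | inj₁ (u , _ , eq₂ , _) = ⊥-elim (none u eq₂)
  ... | inj₂ (_ , eq) = eq

  labelled<nV : ∀ {u w} → lab B₁ u ≡ just w → w < nV B₁
  labelled<nV = I₁.V<nV ∘ I₁.lab-V

  r-injective : ∀ {v v'} → r v ≡ r v' → v ≡ v'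
  r-injective {v} {v'} eq with r-cases v | r-cases v'
  ... | inj₂ (_ , p) | inj₂ (_ , q) = +-cancelˡ-≡ (nV B₁) v v' (trans (sym p) (trans eq q))
  ... | inj₁ (_ , _ , _ , l , p) | inj₂ (_ , q) =
    ⊥-elim (m+n≮m (nV B₁) v' (subst (_< nV B₁) (trans (sym p) (trans eq q)) (labelled<nV l)))
  ... | inj₂ (_ , q) | inj₁ (_ , _ , _ , l , p) =
    ⊥-elim (m+n≮m (nV B₁) v (subst (_< nV B₁) (trans (sym p) (trans (sym eq) q)) (labelled<nV l)))
  ... | inj₁ (u , _ , l₂ , l₁ , p) | inj₁ (u' , _ , l₂' , l₁' , p')
    with I₁.lab-injective l₁ (trans l₁' (cong just (trans (sym p') (trans (sym eq) p))))
  ...   | refl = just-injective (trans (sym l₂) l₂')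

  r< : ∀ {v} → v < nV B₂ → r v < nV B₁ + nV B₂
  r< {v} v< with r-cases v
  ... | inj₁ (_ , _ , _ , l , p) =
    subst (_< nV B₁ + nV B₂) (sym p) (<-≤-trans (labelled<nV l) (m≤m+n (nV B₁) (nV B₂)))
  ... | inj₂ (_ , q) = subst (_< nV B₁ + nV B₂) (sym q) (+-monoʳ-< (nV B₁) v<)

  invariant : Invariant b B' (fs₁ ++ map r fs₂) (es₁ ++ map (mapEdge (nE B₁) r) es₂)
  invariant = record
    { lab-∈ = I₁.lab-∈
    ; lab-dom = I₁.lab-dom
    ; lab-injective = I₁.lab-injective
    ; lab-V = ∈-++⁺ˡ ∘ I₁.lab-V
    ; V<nV = V<nV'
    ; V-cases = V-cases'
    ; forgotten-V = forgotten-V'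
    ; forgotten-unlabelled = unlabelled'
    ; forgotten-unique = Unique.++⁺ I₁.forgotten-unique (Unique.map⁺ r-injective I₂.forgotten-unique) disjoint
    ; E≡ = E≡'
    ; ρ≡ = ρ≡'
    ; edges-unique = edges-unique'
    ; edges<nE = edges<nE'
    ; edges-V = edges-V'
    }
    where
    V<nV' : ∀ {v} → v ∈L V (graph B') → v < nV B₁ + nV B₂
    V<nV' p with ∈-++⁻ (V (graph B₁)) p
    ... | inj₁ q = <-≤-trans (I₁.V<nV q) (m≤m+n (nV B₁) (nV B₂))
    ... | inj₂ q with ∈-map⁻ r q
    ...   | v' , q' , refl = r< (I₂.V<nV q')
    V-cases' : ∀ {v} → v ∈L V (graph B') → v ∈L (fs₁ ++ map r fs₂) ⊎ (∃ λ u → lab B₁ u ≡ just v)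
    V-cases' p with ∈-++⁻ (V (graph B₁)) p
    V-cases' p | inj₁ q with I₁.V-cases q
    ... | inj₁ q' = inj₁ (∈-++⁺ˡ q')
    ... | inj₂ l = inj₂ l
    V-cases' p | inj₂ q with ∈-map⁻ r q
    ... | v' , q' , refl with I₂.V-cases q'
    ...   | inj₁ q'' = inj₁ (∈-++⁺ʳ fs₁ (∈-map⁺ r q''))
    ...   | inj₂ (u , l) with I₁.lab-∈ (I₂.lab-dom l)
    ...     | w , l₁ = inj₂ (u , trans l₁ (cong just (sym (r-labelled l l₁))))
    forgotten-V' : ∀ {v} → v ∈L (fs₁ ++ map r fs₂) → v ∈L V (graph B')
    forgotten-V' p with ∈-++⁻ fs₁ p
    ... | inj₁ q = ∈-++⁺ˡ (I₁.forgotten-V q)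
    ... | inj₂ q with ∈-map⁻ r q
    ...   | v' , q' , refl = ∈-++⁺ʳ (V (graph B₁)) (∈-map⁺ r (I₂.forgotten-V q'))
    r-forgotten : ∀ {v} → v ∈L fs₂ → ¬ r v < nV B₁
    r-forgotten {v} q lt = m+n≮m (nV B₁) v (subst (_< nV B₁) (r-unlabelled (I₂.forgotten-unlabelled q)) lt)
    unlabelled' : ∀ {v} → v ∈L (fs₁ ++ map r fs₂) → ∀ u → lab B₁ u ≢ just v
    unlabelled' p u l with ∈-++⁻ fs₁ p
    ... | inj₁ q = I₁.forgotten-unlabelled q u l
    ... | inj₂ q with ∈-map⁻ r q
    ...   | v' , q' , refl = r-forgotten q' (labelled<nV l)
    disjoint : ∀ {v} → ¬ (v ∈L fs₁ × v ∈L map r fs₂)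
    disjoint (p , q) with ∈-map⁻ r q
    ... | v' , q' , refl = r-forgotten q' (I₁.V<nV (I₁.forgotten-V p))
    shift = mapEdge (nE B₁) r
    E≡' : E (graph B') ≡ map proj₁ (es₁ ++ map shift es₂)
    E≡' = trans (cong₂ (λ x y → x ++ map (nE B₁ +_) y) I₁.E≡ I₂.E≡)
      (trans (cong (map proj₁ es₁ ++_) (trans (sym (map-∘ es₂)) (map-∘ es₂)))
             (sym (map-++ proj₁ es₁ (map shift es₂))))
    shiftInc : ℕ × ℕ → ℕ × ℕ
    shiftInc p = nE B₁ + proj₁ p , r (proj₂ p)
    ρ≡' : ρ (graph B') ≡ concatMap incidences (es₁ ++ map shift es₂)
    ρ≡' = begin
      ρ (graph B₁) ++ map shiftInc (ρ (graph B₂))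
        ≡⟨ cong₂ (λ x y → x ++ map shiftInc y) I₁.ρ≡ I₂.ρ≡ ⟩
      concatMap incidences es₁ ++ map shiftInc (concatMap incidences es₂)
        ≡⟨ cong (concatMap incidences es₁ ++_) (map-concatMap shiftInc incidences es₂) ⟩
      concatMap incidences es₁ ++ concatMap (incidences ∘ shift) es₂
        ≡⟨ cong (concatMap incidences es₁ ++_) (concatMap-map incidences shift es₂) ⟨
      concatMap incidences es₁ ++ concatMap incidences (map shift es₂)
        ≡⟨ concatMap-++ incidences es₁ (map shift es₂) ⟨
      concatMap incidences (es₁ ++ map shift es₂) ∎
      where open ≡-Reasoning
    edges-unique' : Unique (map proj₁ (es₁ ++ map shift es₂))
    edges-unique' = subst Unique
      (trans (cong (map proj₁ es₁ ++_) (trans (sym (map-∘ es₂)) (map-∘ es₂)))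
             (sym (map-++ proj₁ es₁ (map shift es₂))))
      (Unique.++⁺ I₁.edges-unique (Unique.map⁺ (+-cancelˡ-≡ (nE B₁) _ _) I₂.edges-unique) disjointE)
      where
      disjointE : ∀ {e} → ¬ (e ∈L map proj₁ es₁ × e ∈L map (nE B₁ +_) (map proj₁ es₂))
      disjointE (p , q) with ∈-map⁻ proj₁ p | ∈-map⁻ (nE B₁ +_) q
      ... | _ , p' , refl | e' , _ , eq = m+n≮m (nE B₁) e' (subst (_< nE B₁) eq (I₁.edges<nE p'))
    edges<nE' : ∀ {e x y} → (e , x , y) ∈L (es₁ ++ map shift es₂) → e < nE B₁ + nE B₂
    edges<nE' p with ∈-++⁻ es₁ p
    ... | inj₁ q = <-≤-trans (I₁.edges<nE q) (m≤m+n (nE B₁) (nE B₂))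
    ... | inj₂ q with ∈-map⁻ shift q
    ...   | _ , q' , refl = +-monoʳ-< (nE B₁) (I₂.edges<nE q')
    edges-V' : ∀ {e x y} → (e , x , y) ∈L (es₁ ++ map shift es₂) →
      x ∈L V (graph B') × y ∈L V (graph B') × x ≢ y
    edges-V' p with ∈-++⁻ es₁ p
    ... | inj₁ q = let x∈ , y∈ , x≢y = I₁.edges-V q in ∈-++⁺ˡ x∈ , ∈-++⁺ˡ y∈ , x≢y
    ... | inj₂ q with ∈-map⁻ shift q
    ...   | _ , q' , refl = let x∈ , y∈ , x≢y = I₂.edges-V q' in
      ∈-++⁺ʳ (V (graph B₁)) (∈-map⁺ r x∈) , ∈-++⁺ʳ (V (graph B₁)) (∈-map⁺ r y∈) , x≢y ∘ r-injective

∉∅ : ∀ {n} {u : Fin n} → u ∉ ∅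
∉∅ {u = u} p with trans (sym (lookup-replicate u outside)) ([]=⇒lookup p)
... | ()

invariant : ∀ {k} {b : Bag k} {τ} → Legal b τ → Invariant b (build τ) (forgotten τ) (edges τ)
invariant Leaf = record
  { lab-∈ = ⊥-elim ∘ ∉∅ ; lab-dom = λ () ; lab-injective = λ () ; lab-V = λ () ; V<nV = λ ()
  ; V-cases = λ () ; forgotten-V = λ () ; forgotten-unlabelled = λ () ; forgotten-unique = []
  ; E≡ = refl ; ρ≡ = refl ; edges-unique = [] ; edges<nE = λ () ; edges-V = λ () }
invariant (IntroVertex {τ = τ} u u∉b l) = IntroVertexInvariant.invariant τ u u∉b (invariant l)
invariant (ForgetVertex {τ = τ} u u∈b l) = ForgetVertexInvariant.invariant τ u u∈b (invariant l)
invariant (IntroEdge {b} {τ} u v u≢v u∈b v∈b l) = helper (proj₂ (lab-∈ u∈b)) (proj₂ (lab-∈ v∈b))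
  where
  open Invariant (invariant l)
  helper : ∀ {x y} → lab (build τ) u ≡ just x → lab (build τ) v ≡ just y →
    Invariant b (build (IntroEdge u v τ)) (forgotten τ) (edges (IntroEdge u v τ))
  helper {x} {y} lu lv = subst (λ B → Invariant b B (forgotten τ) (edges (IntroEdge u v τ)))
    (sym (build-IntroEdge u v τ lu lv))
    (subst (λ es → Invariant b (addEdge x y (build τ)) (forgotten τ) (es ++ edges τ))
      (sym (cong₂ (newEdge (nE (build τ))) lu lv))
      (addEdge-invariant (lab-V lu) (lab-V lv) (λ { refl → u≢v (lab-injective lu lv) }) (invariant l)))
invariant (Join {τ = τ} {τ'} l l') = JoinInvariant.invariant τ τ' (invariant l) (invariant l')

-- Semantics of the witnesses

module Semantics (S : Spec) where
  open CountingCore S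

  Colouring : Set
  Colouring = ℕ → Colour

  edgeWeight : Colouring → Edge → Bool
  edgeWeight c (e , x , y) = wE (c x) (c y)

  bagColours : ∀ {k} → LGraph k → Colouring → Vec (Maybe Colour) (suc k)
  bagColours B c = tabulate (Maybe.map c ∘ lab B)

  summary : ∀ {k} → Term k → Colouring → At.State k
  summary τ c = bagColours (build τ) c
              , clip capV (count (wV ∘ c) (forgotten τ))
              , clip capE (count (edgeWeight c) (edges τ))

  bagColours-lookup : ∀ {k} (B : LGraph k) c u → lookup (bagColours B c) u ≡ Maybe.map c (lab B u)
  bagColours-lookup B c = lookup∘tabulate (Maybe.map c ∘ lab B)

  lookup-bagColours : ∀ {k} (B : LGraph k) c {u v} → lab B u ≡ just v →
    lookup (bagColours B c) u ≡ just (c v)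
  lookup-bagColours B c {u} eq = trans (bagColours-lookup B c u) (cong (Maybe.map c) eq)

  summary-cong : ∀ {k} {b : Bag k} {τ} → Legal b τ → ∀ {c c'} →
    (∀ {v} → v < nV (build τ) → c v ≡ c' v) → summary τ c ≡ summary τ c'
  summary-cong {τ = τ} l {c} {c'} eq = cong₂ _,_ (tabulate-cong bag) (cong₂ (λ x y → clip capV x , clip capE y)
    (count-cong (forgotten τ) (λ p → cong wV (eq (V<nV (forgotten-V p)))))
    (count-cong (edges τ) (λ p → let x∈ , y∈ , _ = edges-V p in cong₂ wE (eq (V<nV x∈)) (eq (V<nV y∈)))))
    where
    open Invariant (invariant l)
    bag : ∀ u → Maybe.map c (lab (build τ) u) ≡ Maybe.map c' (lab (build τ) u)
    bag u with lab (build τ) u in lu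
    ... | nothing = refl
    ... | just v = cong just (eq (V<nV (lab-V lu)))

  summary-introVertex : ∀ {k} {b : Bag k} u τ → u ∉ b → Legal b τ → ∀ c →
    summary (IntroVertex u τ) c ≡ At.introVertexS k u (c (nV (build τ))) (summary τ c)
  summary-introVertex u τ u∉b l c = cong (_, _) (vec-ext pointwise)
    where
    open IntroVertexInvariant τ u u∉b (invariant l)
    pointwise : ∀ x → lookup (bagColours B' c) x ≡ lookup (bagColours B c [ u ]≔ just (c (nV B))) x
    pointwise x with x ≟F u
    ... | yes refl = trans (lookup-bagColours B' c lab-new) (sym (lookup∘update u (bagColours B c) _))
    ... | no x≢u = trans (bagColours-lookup B' c x) (trans (cong (Maybe.map c) (lab-old x≢u))
      (trans (sym (bagColours-lookup B c x)) (sym (lookup∘update′ x≢u (bagColours B c) _))))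

  summary-forgetVertex : ∀ {k} {b : Bag k} u τ → u ∈ b → Legal b τ → ∀ c →
    At.forgetVertexS k u (summary τ c) ≡ [ summary (ForgetVertex u τ) c ]
  summary-forgetVertex {k} u τ u∈b l c =
    trans (cong (At.forgetWith k u (summary τ c)) (lookup-bagColours B c lab-u))
      (cong [_] (cong₂ (λ x i → x , i , clip capE (count (edgeWeight c) (edges τ))) (vec-ext pointwise) counter))
    where
    open ForgetVertexInvariant τ u u∈b (invariant l)
    n : ℕ
    n = count (wV ∘ c) (forgotten τ)
    pointwise : ∀ x → lookup (bagColours B c [ u ]≔ nothing) x ≡ lookup (bagColours B' c) x
    pointwise x with x ≟F u
    ... | yes refl = trans (lookup∘update u (bagColours B c) _)
      (sym (trans (bagColours-lookup B' c u) (cong (Maybe.map c) lab-gone)))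
    ... | no x≢u = trans (lookup∘update′ x≢u (bagColours B c) _) (trans (bagColours-lookup B c x)
      (trans (cong (Maybe.map c) (sym (lab-other x≢u))) (sym (bagColours-lookup B' c x))))
    counter : clip capV (toℕ (clip capV n) + bit (wV (c a)))
      ≡ clip capV (count (wV ∘ c) (fromMaybe (lab B u) ++ forgotten τ))
    counter = trans (clip-+ capV n _) (trans (cong (clip capV) (+-comm n _))
      (cong (λ m → clip capV (count (wV ∘ c) (fromMaybe m ++ forgotten τ))) (sym lab-u)))

  summary-introEdge : ∀ {k} {b : Bag k} u v τ → u ∈ b → v ∈ b → Legal b τ → ∀ c →
    At.introEdgeS k u v (summary τ c) ≡ [ summary (IntroEdge u v τ) c ]
  summary-introEdge {k} u v τ u∈b v∈b l c with Invariant.lab-∈ (invariant l) u∈b | Invariant.lab-∈ (invariant l) v∈b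
  ... | x , lu | y , lv =
    trans (cong₂ (At.edgeWith k (summary τ c)) (lookup-bagColours (build τ) c lu) (lookup-bagColours (build τ) c lv))
      (cong [_] (cong₂ (λ B j → bagColours B c , clip capV (count (wV ∘ c) (forgotten τ)) , j) {x = addEdge x y (build τ)}
        (sym (build-IntroEdge u v τ lu lv)) counter))
    where
    m : ℕ
    m = count (edgeWeight c) (edges τ)
    counter : clip capE (toℕ (clip capE m) + bit (wE (c x) (c y)))
      ≡ clip capE (count (edgeWeight c) (edges (IntroEdge u v τ)))
    counter = trans (clip-+ capE m _) (trans (cong (clip capE) (+-comm m _))
      (cong (λ es → clip capE (count (edgeWeight c) (es ++ edges τ))) (sym (cong₂ (newEdge (nE (build τ))) lu lv))))

  joinS-≡ : ∀ {k} (s s' : At.State k) → proj₁ s ≡ proj₁ s' → At.joinS k s s' ≡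
    [ proj₁ s , clip capV (toℕ (proj₁ (proj₂ s)) + toℕ (proj₁ (proj₂ s')))
              , clip capE (toℕ (proj₂ (proj₂ s)) + toℕ (proj₂ (proj₂ s'))) ]
  joinS-≡ (x , _) (x' , _) eq with Vec-≡-dec (Maybe-≡-dec _≟F_) x x'
  ... | yes _ = refl
  ... | no ¬p = ⊥-elim (¬p eq)

  joinS-∈ : ∀ {k} (s s' : At.State k) {t} → t ∈L At.joinS k s s' → proj₁ s ≡ proj₁ s'
  joinS-∈ (x , _) (x' , _) p with Vec-≡-dec (Maybe-≡-dec _≟F_) x x'
  ... | yes eq = eq

  summary-join : ∀ {k} {b : Bag k} τ τ' → Legal b τ → Legal b τ' → ∀ c →
    At.joinS k (summary τ c) (summary τ' (c ∘ joinRen (build τ) (build τ'))) ≡ [ summary (Join τ τ') c ]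
  summary-join τ τ' l l' c = trans (joinS-≡ (summary τ c) (summary τ' (c ∘ r)) (tabulate-cong bag))
    (cong [_] (cong₂ (λ i j → bagColours B₁ c , i , j)
      (trans (clip-+-clip capV nV₁ nV₂) (cong (clip capV) (trans
        (cong (nV₁ +_) (sym (count-map (wV ∘ c) r (forgotten τ'))))
        (sym (count-++ (wV ∘ c) (forgotten τ) _)))))
      (trans (clip-+-clip capE nE₁ nE₂) (cong (clip capE) (trans
        (cong (nE₁ +_) (sym (count-map (edgeWeight c) (mapEdge (nE B₁) r) (edges τ'))))
        (sym (count-++ (edgeWeight c) (edges τ) _)))))))
    where
    open JoinInvariant τ τ' (invariant l) (invariant l')
    nV₁ nV₂ nE₁ nE₂ : ℕ
    nV₁ = count (wV ∘ c) (forgotten τ)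
    nV₂ = count (wV ∘ c ∘ r) (forgotten τ')
    nE₁ = count (edgeWeight c) (edges τ)
    nE₂ = count (edgeWeight (c ∘ r)) (edges τ')
    bag : ∀ u → Maybe.map c (lab B₁ u) ≡ Maybe.map (c ∘ r) (lab B₂ u)
    bag u with lab B₁ u in l₁ | lab B₂ u in l₂
    ... | nothing | nothing = refl
    ... | just w | just v = cong (just ∘ c) (sym (r-labelled l₂ l₁))
    ... | just w | nothing with trans (sym l₂) (proj₂ (I₂.lab-∈ (I₁.lab-dom l₁)))
    ...   | ()
    bag u | nothing | just v with trans (sym l₁) (proj₂ (I₁.lab-∈ (I₂.lab-dom l₂)))
    ...   | ()

  module _ {k : ℕ} where
    open At k using (State; enc; lift₁; lift₂; lift₁-enc; lift₂-enc; joinS; introVertexS)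

    lift₁-∈⁺ : ∀ h {S s t} → enc s ∈L S → t ∈L h s → enc t ∈L concatMap (lift₁ h) S
    lift₁-∈⁺ h {s = s} s∈S t∈ =
      ∈-concatMap⁺ (lift₁ h) (lose s∈S (subst (_ ∈L_) (sym (lift₁-enc h s)) (∈-map⁺ enc t∈)))

    lift₁-∈⁻ : ∀ h {S} (g : Colouring → State) → (∀ {w} → w ∈L S → ∃ λ c → w ≡ enc (g c)) →
      ∀ {w} → w ∈L concatMap (lift₁ h) S → ∃₂ λ c t → t ∈L h (g c) × w ≡ enc t
    lift₁-∈⁻ h {S} g sub {w} p with find (∈-concatMap⁻ (lift₁ h) {xs = S} p)
    ... | w₀ , w₀∈S , q with sub w₀∈S
    ... | c , refl with ∈-map⁻ enc (subst (w ∈L_) (lift₁-enc h (g c)) q)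
    ... | t , t∈ , eq = c , t , t∈ , eq

    Dyn-complete : ∀ {b τ} → Legal b τ → ∀ c → enc (summary τ c) ∈L Dyn (countingCore k) τ
    Dyn-complete Leaf c = here (cong (λ x → enc (x , proj₂ (At.leafS k))) (vec-ext (λ u →
      trans (lookup∘tabulate _ u) (sym (lookup-replicate u nothing)))))
    Dyn-complete (IntroVertex {τ = τ} u u∉b l) c = lift₁-∈⁺ (At.introVerticesS k u) (Dyn-complete l c)
      (subst (_∈L At.introVerticesS k u (summary τ c)) (sym (summary-introVertex u τ u∉b l c))
        (∈-map⁺ (λ a → introVertexS u a (summary τ c)) (∈-allFin (c (nV (build τ))))))
    Dyn-complete (ForgetVertex {τ = τ} u u∈b l) c = lift₁-∈⁺ (At.forgetVertexS k u) (Dyn-complete l c)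
      (subst (summary (ForgetVertex u τ) c ∈L_) (sym (summary-forgetVertex u τ u∈b l c)) (here refl))
    Dyn-complete (IntroEdge {τ = τ} u v _ u∈b v∈b l) c = lift₁-∈⁺ (At.introEdgeS k u v) (Dyn-complete l c)
      (subst (summary (IntroEdge u v τ) c ∈L_) (sym (summary-introEdge u v τ u∈b v∈b l c)) (here refl))
    Dyn-complete (Join {τ = τ} {τ'} l l') c =
      ∈-concatMap⁺ _ (lose (Dyn-complete l c) (∈-concatMap⁺ _ (lose (Dyn-complete l' c')
        (subst (enc (summary (Join τ τ') c) ∈L_) (sym (lift₂-enc joinS (summary τ c) (summary τ' c'))) (∈-map⁺ enc
          (subst (summary (Join τ τ') c ∈L_) (sym (summary-join τ τ' l l' c)) (here refl)))))))
      where
      c' : Colouring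
      c' = c ∘ joinRen (build τ) (build τ')

    Dyn-sound : ∀ {b τ} → Legal b τ → ∀ {w} → w ∈L Dyn (countingCore k) τ → ∃ λ c → w ≡ enc (summary τ c)
    Dyn-sound Leaf (here refl) = (λ _ → colour₀) , cong (λ x → enc (x , proj₂ (At.leafS k))) (vec-ext (λ u →
      trans (lookup-replicate u nothing) (sym (lookup∘tabulate _ u))))
    Dyn-sound (IntroVertex {τ = τ} u u∉b l) p
      with lift₁-∈⁻ (At.introVerticesS k u) (summary τ) (Dyn-sound l) p
    ... | c , t , t∈ , refl with ∈-map⁻ (λ a → introVertexS u a (summary τ c)) t∈
    ... | a , _ , refl = c' , cong enc (sym (trans (summary-introVertex u τ u∉b l c')
      (cong₂ (introVertexS u) c'-new (summary-cong l c'-old))))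
      where
      n : ℕ
      n = nV (build τ)
      c' : Colouring
      c' v = if does (v ≟ n) then a else c v
      c'-new : c' n ≡ a
      c'-new rewrite dec-true (n ≟ n) refl = refl
      c'-old : ∀ {v} → v < n → c' v ≡ c v
      c'-old {v} v<n rewrite dec-false (v ≟ n) (<⇒≢ v<n) = refl
    Dyn-sound (ForgetVertex {τ = τ} u u∈b l) p
      with lift₁-∈⁻ (At.forgetVertexS k u) (summary τ) (Dyn-sound l) p
    ... | c , t , t∈ , refl with subst (t ∈L_) (summary-forgetVertex u τ u∈b l c) t∈
    ... | here refl = c , refl
    Dyn-sound (IntroEdge {τ = τ} u v _ u∈b v∈b l) p
      with lift₁-∈⁻ (At.introEdgeS k u v) (summary τ) (Dyn-sound l) p
    ... | c , t , t∈ , refl with subst (t ∈L_) (summary-introEdge u v τ u∈b v∈b l c) t∈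
    ... | here refl = c , refl
    Dyn-sound (Join {τ = τ} {τ'} l l') {w} p
      with find (∈-concatMap⁻ _ {xs = Dyn (countingCore k) τ} p)
    ... | w₁ , w₁∈ , q with find (∈-concatMap⁻ _ {xs = Dyn (countingCore k) τ'} q)
    ... | w₂ , w₂∈ , q' with Dyn-sound l w₁∈ | Dyn-sound l' w₂∈
    ... | c₁ , refl | c₂ , refl with ∈-map⁻ enc (subst (w ∈L_) (lift₂-enc joinS (summary τ c₁) (summary τ' c₂)) q')
    ... | t , t∈ , refl = c , cong enc t≡
      where
      open JoinInvariant τ τ' (invariant l) (invariant l')
      bags≡ : bagColours B₁ c₁ ≡ bagColours B₂ c₂
      bags≡ = joinS-∈ (summary τ c₁) (summary τ' c₂) t∈
      c : Colouring
      c v = if does (v <? nV B₁) then c₁ v else c₂ (v ∸ nV B₁)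
      c-left : ∀ {v} → v < nV B₁ → c v ≡ c₁ v
      c-left {v} v< rewrite dec-true (v <? nV B₁) v< = refl
      c-right : ∀ v → c (nV B₁ + v) ≡ c₂ v
      c-right v rewrite dec-false (nV B₁ + v <? nV B₁) (m+n≮m (nV B₁) v) = cong c₂ (m+n∸m≡n (nV B₁) v)
      c∘r : ∀ v → c (r v) ≡ c₂ v
      c∘r v with r-cases v
      ... | inj₂ (_ , rv) = trans (cong c rv) (c-right v)
      ... | inj₁ (u , x , l₂ , l₁ , rv) = trans (cong c rv) (trans (c-left (labelled<nV l₁))
        (just-injective (trans (sym (lookup-bagColours B₁ c₁ l₁))
          (trans (cong (λ x → lookup x u) bags≡) (lookup-bagColours B₂ c₂ l₂)))))
      t≡ : t ≡ summary (Join τ τ') c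
      t≡ with subst (t ∈L_) (trans (cong₂ joinS (summary-cong l (sym ∘ c-left)) (summary-cong l' (λ {v} _ → sym (c∘r v))))
        (summary-join τ τ' l l' c)) t∈
      ... | here eq = eq

  record Satisfies (G : RawGraph) (c : Colouring) (e : ℕ) : Set where
    constructor satisfies
    field
      {end₁ end₂} : ℕ
      end₁∈ : end₁ ∈L V G
      end₂∈ : end₂ ∈L V G
      inc₁ : (e , end₁) ∈L ρ G
      inc₂ : (e , end₂) ∈L ρ G
      distinct : end₁ ≢ end₂
      heavy : T (wE (c end₁) (c end₂))

  record Tally (G : RawGraph) (c : Colouring) (L M : List ℕ) : Set where
    field
      L-unique : Unique L
      L-spec : ∀ v → v ∈L L ⇔ (v ∈L V G × T (wV (c v)))
      M-unique : Unique M
      M-spec : ∀ e → e ∈L M ⇔ (e ∈L E G × Satisfies G c e)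

  Accepted : List ℕ → List ℕ → Set
  Accepted L M = T (accept (length L ⊓ capV) (length M ⊓ capE))

  Models : RawGraph → Set
  Models G = ∃ λ c → ∃₂ λ L M → Tally G c L M × Accepted L M

  tally-accepted : ∀ {G c L M L' M'} → Tally G c L M → Tally G c L' M' → Accepted L M → Accepted L' M'
  tally-accepted t t' = subst T (cong₂ (λ x y → accept (x ⊓ capV) (y ⊓ capE))
    (≐⇒length≡ T₁.L-unique T₂.L-unique T₁.L-spec T₂.L-spec)
    (≐⇒length≡ T₁.M-unique T₂.M-unique T₁.M-spec T₂.M-spec))
    where
    module T₁ = Tally t
    module T₂ = Tally t'

∈-mapMaybe⁺ : ∀ {A B : Set} (f : A → Maybe B) {x y xs} → x ∈L xs → f x ≡ just y → y ∈L mapMaybe f xs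
∈-mapMaybe⁺ f {x} (here refl) eq with f x
∈-mapMaybe⁺ f {x} (here refl) refl | just _ = here refl
∈-mapMaybe⁺ f {xs = x' ∷ _} (there p) eq with f x'
... | nothing = ∈-mapMaybe⁺ f p eq
... | just _ = there (∈-mapMaybe⁺ f p eq)

∈-mapMaybe⁻ : ∀ {A B : Set} (f : A → Maybe B) {y} xs → y ∈L mapMaybe f xs → ∃ λ x → x ∈L xs × f x ≡ just y
∈-mapMaybe⁻ f (x ∷ xs) p with f x in eq
∈-mapMaybe⁻ f (x ∷ xs) p | nothing with ∈-mapMaybe⁻ f xs p
... | x' , q , eq' = x' , there q , eq'
∈-mapMaybe⁻ f (x ∷ xs) (here refl) | just _ = x , here refl , eq
∈-mapMaybe⁻ f (x ∷ xs) (there p) | just _ with ∈-mapMaybe⁻ f xs p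
... | x' , q , eq' = x' , there q , eq'

Unique-mapMaybe : ∀ {A B : Set} (f : A → Maybe B) → (∀ {x x' y} → f x ≡ just y → f x' ≡ just y → x ≡ x') →
  ∀ {xs} → Unique xs → Unique (mapMaybe f xs)
Unique-mapMaybe f inj [] = []
Unique-mapMaybe f inj {x ∷ xs} (x∉ ∷ u) with f x in eq
... | nothing = Unique-mapMaybe f inj u
... | just y = All.tabulate fresh ∷ Unique-mapMaybe f inj u
  where
  fresh : ∀ {y'} → y' ∈L mapMaybe f xs → y ≢ y'
  fresh p refl with ∈-mapMaybe⁻ f xs p
  ... | x' , x'∈ , eq' = All.lookup x∉ x'∈ (inj eq eq')

Unique-key : ∀ {A B : Set} (f : A → B) {xs x y} → Unique (map f xs) → x ∈L xs → y ∈L xs → f x ≡ f y → x ≡ y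
Unique-key f (_ ∷ u) (here refl) (here refl) eq = refl
Unique-key f (x∉ ∷ u) (here refl) (there q) eq = ⊥-elim (All.lookup x∉ (∈-map⁺ f q) eq)
Unique-key f (x∉ ∷ u) (there p) (here refl) eq = ⊥-elim (All.lookup x∉ (∈-map⁺ f p) (sym eq))
Unique-key f (_ ∷ u) (there p) (there q) eq = Unique-key f u p q eq

≅-sym : ∀ {G H} → G ≅ H → H ≅ G
≅-sym {G} {H} i = record
  { fV = gV ; gV = fV ; fE = gE ; gE = fE ; fV∈ = gV∈ ; gV∈ = fV∈ ; gfV = fgV ; fgV = gfV
  ; fE∈ = gE∈ ; gE∈ = fE∈ ; gfE = fgE ; fgE = gfE ; pres = pres' }
  where
  open _≅_ i
  pres' : ∀ {e v} → e ∈L E H → v ∈L V H → ((e , v) ∈L ρ H ⇔ (gE e , gV v) ∈L ρ G)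
  pres' e∈ v∈ with pres (gE∈ e∈) (gV∈ v∈)
  ... | to , from = (λ p → from (subst (_∈L ρ H) (sym (cong₂ _,_ (fgE e∈) (fgV v∈))) p))
                  , (λ p → subst (_∈L ρ H) (cong₂ _,_ (fgE e∈) (fgV v∈)) (to p))

module Correctness (S : Spec) where
  open CountingCore S
  open Semantics S

  module TermTally {k} {b : Bag k} {τ : Term k} (l : Legal b τ) (c : Colouring) where
    open Invariant (invariant l)
    B : LGraph k
    B = build τ

    vertices heavyVertices heavyEdges : List ℕ
    vertices = forgotten τ ++ mapMaybe (lab B) (allFin (suc k))
    heavyVertices = filterᵇ (wV ∘ c) vertices
    heavyEdges = map proj₁ (filterᵇ (edgeWeight c) (edges τ))

    vertices-unique : Unique vertices
    vertices-unique = Unique.++⁺ forgotten-unique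
      (Unique-mapMaybe (lab B) lab-injective (Unique.allFin⁺ (suc k)))
      λ (p , q) → let u , _ , lu = ∈-mapMaybe⁻ (lab B) (allFin (suc k)) q in forgotten-unlabelled p u lu

    V⊆vertices : ∀ {v} → v ∈L V (graph B) → v ∈L vertices
    V⊆vertices p with V-cases p
    ... | inj₁ q = ∈-++⁺ˡ q
    ... | inj₂ (u , lu) = ∈-++⁺ʳ (forgotten τ) (∈-mapMaybe⁺ (lab B) (∈-allFin u) lu)

    vertices⊆V : ∀ {v} → v ∈L vertices → v ∈L V (graph B)
    vertices⊆V p with ∈-++⁻ (forgotten τ) p
    ... | inj₁ q = forgotten-V q
    ... | inj₂ q = lab-V (proj₂ (proj₂ (∈-mapMaybe⁻ (lab B) (allFin (suc k)) q)))

    ρ⁺ : ∀ {e x y v} → (e , x , y) ∈L edges τ → v ≡ x ⊎ v ≡ y → (e , v) ∈L ρ (graph B)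
    ρ⁺ {e} {x} {y} p q = subst (_ ∈L_) (sym ρ≡) (∈-concatMap⁺ incidences (lose p (helper q)))
      where
      helper : ∀ {v} → v ≡ x ⊎ v ≡ y → (e , v) ∈L incidences (e , x , y)
      helper (inj₁ refl) = here refl
      helper (inj₂ refl) = there (here refl)

    ρ⁻ : ∀ {e v} → (e , v) ∈L ρ (graph B) → ∃₂ λ x y → (e , x , y) ∈L edges τ × (v ≡ x ⊎ v ≡ y)
    ρ⁻ p with find (∈-concatMap⁻ incidences {xs = edges τ} (subst (_ ∈L_) ρ≡ p))
    ... | (_ , x , y) , q , here refl = x , y , q , inj₁ refl
    ... | (_ , x , y) , q , there (here refl) = x , y , q , inj₂ refl

    E⁻ : ∀ {e} → e ∈L E (graph B) → ∃₂ λ x y → (e , x , y) ∈L edges τ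
    E⁻ p with ∈-map⁻ proj₁ (subst (_ ∈L_) E≡ p)
    ... | (_ , x , y) , q , refl = x , y , q

    E⁺ : ∀ {e x y} → (e , x , y) ∈L edges τ → e ∈L E (graph B)
    E⁺ p = subst (_ ∈L_) (sym E≡) (∈-map⁺ proj₁ p)

    tally : Tally (graph B) c heavyVertices heavyEdges
    tally = record
      { L-unique = Unique.filter⁺ (Bool.T? ∘ wV ∘ c) vertices-unique
      ; L-spec = λ v →
          (λ p → let q , h = ∈-filter⁻ (Bool.T? ∘ wV ∘ c) {xs = vertices} p in vertices⊆V q , h)
        , (λ (p , h) → ∈-filter⁺ (Bool.T? ∘ wV ∘ c) (V⊆vertices p) h)
      ; M-unique = AllPairs.map⁺ (AllPairs.filter⁺ (Bool.T? ∘ edgeWeight c) (AllPairs.map⁻ edges-unique))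
      ; M-spec = λ e → to , from
      }
      where
      to : ∀ {e} → e ∈L heavyEdges → e ∈L E (graph B) × Satisfies (graph B) c e
      to p with ∈-map⁻ proj₁ p
      ... | (e , x , y) , q , refl with ∈-filter⁻ (Bool.T? ∘ edgeWeight c) {xs = edges τ} q
      ... | q' , h = let x∈ , y∈ , x≢y = edges-V q' in
        E⁺ q' , satisfies x∈ y∈ (ρ⁺ q' (inj₁ refl)) (ρ⁺ q' (inj₂ refl)) x≢y h
      heavy-edge : ∀ {x y u v} → u ≡ x ⊎ u ≡ y → v ≡ x ⊎ v ≡ y → u ≢ v →
        T (wE (c u) (c v)) → T (wE (c x) (c y))
      heavy-edge (inj₁ refl) (inj₁ refl) u≢v h = ⊥-elim (u≢v refl)
      heavy-edge (inj₁ refl) (inj₂ refl) u≢v h = h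
      heavy-edge (inj₂ refl) (inj₁ refl) u≢v h = subst T (wE-sym _ _) h
      heavy-edge (inj₂ refl) (inj₂ refl) u≢v h = ⊥-elim (u≢v refl)
      from : ∀ {e} → e ∈L E (graph B) × Satisfies (graph B) c e → e ∈L heavyEdges
      from (e∈ , satisfies _ _ i₁ i₂ u≢v h) with E⁻ e∈ | ρ⁻ i₁ | ρ⁻ i₂
      ... | x , y , p | _ , _ , q₁ , j₁ | _ , _ , q₂ , j₂
        with Unique-key proj₁ edges-unique q₁ p refl | Unique-key proj₁ edges-unique q₂ p refl
      ... | refl | refl = ∈-map⁺ proj₁ (∈-filter⁺ (Bool.T? ∘ edgeWeight c) p (heavy-edge j₁ j₂ u≢v h))

    weight-bag : ∀ us → count (maybe′ wV false ∘ lookup (bagColours B c)) us ≡ count (wV ∘ c) (mapMaybe (lab B) us)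
    weight-bag [] = refl
    weight-bag (u ∷ us) rewrite bagColours-lookup B c u with lab B u
    ... | nothing = weight-bag us
    ... | just v = cong (bit (wV (c v)) +_) (weight-bag us)

    finalS-summary : At.finalS k (summary τ c) ≡ accept (length heavyVertices ⊓ capV) (length heavyEdges ⊓ capE)
    finalS-summary = cong₂ accept vertexCounter edgeCounter
      where
      open ≡-Reasoning
      n : ℕ
      n = count (wV ∘ c) (forgotten τ)
      bagWeight : ℕ
      bagWeight = At.weight k wV (bagColours B c)
      vertexCounter : toℕ (clip capV (toℕ (clip capV n) + bagWeight)) ≡ length heavyVertices ⊓ capV
      vertexCounter = begin
        toℕ (clip capV (toℕ (clip capV n) + bagWeight)) ≡⟨ cong toℕ (clip-+ capV n bagWeight) ⟩
        toℕ (clip capV (n + bagWeight)) ≡⟨ toℕ-clip capV _ ⟩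
        (n + bagWeight) ⊓ capV ≡⟨ cong (λ m → (n + m) ⊓ capV) (weight-bag (allFin (suc k))) ⟩
        (n + count (wV ∘ c) (mapMaybe (lab B) (allFin (suc k)))) ⊓ capV
          ≡⟨ cong (_⊓ capV) (count-++ (wV ∘ c) (forgotten τ) _) ⟨
        count (wV ∘ c) vertices ⊓ capV ≡⟨ cong (_⊓ capV) (length-filterᵇ (wV ∘ c) vertices) ⟨
        length heavyVertices ⊓ capV ∎
      edgeCounter : toℕ (clip capE (count (edgeWeight c) (edges τ))) ≡ length heavyEdges ⊓ capE
      edgeCounter = trans (toℕ-clip capE _) (cong (_⊓ capE) (sym (trans
        (length-map proj₁ (filterᵇ (edgeWeight c) (edges τ))) (length-filterᵇ (edgeWeight c) (edges τ)))))

  accepts⇔models : ∀ {k} {b : Bag k} {τ} → Legal b τ → Accepts (countingCore k) τ ⇔ Models G⟦ τ ⟧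
  accepts⇔models {k} {b} {τ} l = to , from
    where
    open At k using (enc; onCode-enc; finalS)
    to : Accepts (countingCore k) τ → Models G⟦ τ ⟧
    to a with find a
    ... | w , w∈ , final with Dyn-sound l w∈
    ... | c , refl = c , heavyVertices , heavyEdges , tally
      , subst T (trans (onCode-enc false finalS (summary τ c)) finalS-summary) final
      where open TermTally l c
    from : Models G⟦ τ ⟧ → Accepts (countingCore k) τ
    from (c , L , M , t , ok) = lose (Dyn-complete l c)
      (subst T (sym (trans (onCode-enc false finalS (summary τ c)) finalS-summary)) (tally-accepted t tally ok))
      where open TermTally l c

  models-≅ : ∀ {G H} → G ≅ H → Models G → Models H
  models-≅ {G} {H} i (c , L , M , t , ok) = c ∘ gV , map fV L , map fE M , record
    { L-unique = Unique-map (λ {x} {y} p q eq → injV (proj₁ (proj₁ (L-spec x) p)) (proj₁ (proj₁ (L-spec y) q)) eq) L-unique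
    ; L-spec = λ v → L-to , L-from
    ; M-unique = Unique-map (λ {x} {y} p q eq → injE (proj₁ (proj₁ (M-spec x) p)) (proj₁ (proj₁ (M-spec y) q)) eq) M-unique
    ; M-spec = λ e → M-to , M-from
    } , subst T (sym (cong₂ (λ x y → accept (x ⊓ capV) (y ⊓ capE)) (length-map fV L) (length-map fE M))) ok
    where
    open _≅_ i
    open Tally t
    injV : ∀ {x y} → x ∈L V G → y ∈L V G → fV x ≡ fV y → x ≡ y
    injV p q eq = trans (sym (gfV p)) (trans (cong gV eq) (gfV q))
    injE : ∀ {x y} → x ∈L E G → y ∈L E G → fE x ≡ fE y → x ≡ y
    injE p q eq = trans (sym (gfE p)) (trans (cong gE eq) (gfE q))
    L-to : ∀ {v} → v ∈L map fV L → v ∈L V H × T (wV (c (gV v)))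
    L-to p with ∈-map⁻ fV p
    ... | x , q , refl with proj₁ (L-spec x) q
    ... | x∈ , h = fV∈ x∈ , subst (T ∘ wV ∘ c) (sym (gfV x∈)) h
    L-from : ∀ {v} → v ∈L V H × T (wV (c (gV v))) → v ∈L map fV L
    L-from {v} (v∈ , h) = subst (_∈L map fV L) (fgV v∈) (∈-map⁺ fV (proj₂ (L-spec (gV v)) (gV∈ v∈ , h)))
    M-to : ∀ {e} → e ∈L map fE M → e ∈L E H × Satisfies H (c ∘ gV) e
    M-to p with ∈-map⁻ fE p
    ... | e , q , refl with proj₁ (M-spec e) q
    ... | e∈ , satisfies u∈ v∈ i₁ i₂ u≢v h = fE∈ e∈ , satisfies (fV∈ u∈) (fV∈ v∈)
      (proj₁ (pres e∈ u∈) i₁) (proj₁ (pres e∈ v∈) i₂) (u≢v ∘ injV u∈ v∈)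
      (subst T (cong₂ (λ x y → wE (c x) (c y)) (sym (gfV u∈)) (sym (gfV v∈))) h)
    M-from : ∀ {e} → e ∈L E H × Satisfies H (c ∘ gV) e → e ∈L map fE M
    M-from {e} (e∈ , satisfies u∈ v∈ i₁ i₂ u≢v h) = subst (_∈L map fE M) (fgE e∈) (∈-map⁺ fE
      (proj₂ (M-spec (gE e)) (gE∈ e∈ , satisfies (gV∈ u∈) (gV∈ v∈)
        (proj₁ (_≅_.pres (≅-sym i) e∈ u∈) i₁) (proj₁ (_≅_.pres (≅-sym i) e∈ v∈) i₂)
        (λ eq → u≢v (trans (sym (fgV u∈)) (trans (cong fV eq) (fgV v∈)))) h)))

  coherent : Coherent countingCore
  coherent k k' b b' τ τ' l l' i =
      (λ a → proj₂ (accepts⇔models l') (models-≅ i (proj₁ (accepts⇔models l) a)))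
    , (λ a → proj₂ (accepts⇔models l) (models-≅ (≅-sym i) (proj₁ (accepts⇔models l') a)))

  satisfies? : ∀ G c → Decidable (Satisfies G c)
  satisfies? G c e = map′ to from (Any.any? (λ u → Any.any? (λ v → end? u v) (V G)) (V G))
    where
    Ends : ℕ → ℕ → Set
    Ends u v = ((e , u) ∈L ρ G) × ((e , v) ∈L ρ G) × (u ≢ v) × T (wE (c u) (c v))
    end? : ∀ u v → Dec (Ends u v)
    end? u v = ∈?-with _≟ℕ×ℕ_ (e , u) (ρ G) ×-dec ∈?-with _≟ℕ×ℕ_ (e , v) (ρ G) ×-dec ¬? (u ≟ v) ×-dec Bool.T? _
    to : Any (λ u → Any (Ends u) (V G)) (V G) → Satisfies G c e
    to p with find p
    ... | u , u∈ , q with find q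
    ... | v , v∈ , i₁ , i₂ , u≢v , h = satisfies u∈ v∈ i₁ i₂ u≢v h
    from : Satisfies G c e → Any (λ u → Any (Ends u) (V G)) (V G)
    from (satisfies u∈ v∈ i₁ i₂ u≢v h) = lose u∈ (lose v∈ (i₁ , i₂ , u≢v , h))

  heavyEdgesOf : RawGraph → Colouring → List ℕ
  heavyEdgesOf G c = filter (satisfies? G c) (deduplicate _≟_ (E G))

  tallyOf : ∀ G c {L} → Unique L → (∀ v → v ∈L L ⇔ (v ∈L V G × T (wV (c v)))) → Tally G c L (heavyEdgesOf G c)
  tallyOf G c uL specL = record
    { L-unique = uL
    ; L-spec = specL
    ; M-unique = Unique.filter⁺ (satisfies? G c) (DecUnique.deduplicate-! _≟_ (E G))
    ; M-spec = λ e →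
        (λ p → let q , h = ∈-filter⁻ (satisfies? G c) {xs = deduplicate _≟_ (E G)} p in ∈-deduplicate⁻ _≟_ (E G) q , h)
      , (λ (p , h) → ∈-filter⁺ (satisfies? G c) (∈-deduplicate⁺ _≟_ p) h)
    }

-- Representing a graph by a term

-- Positions count from the end of the list, like the fresh names of build.
nth : List ℕ → ℕ → ℕ
nth [] n = 0
nth (x ∷ xs) n with n ≟ length xs
... | yes _ = x
... | no _ = nth xs n

position : List ℕ → ℕ → ℕ
position [] y = 0
position (x ∷ xs) y with y ≟ x
... | yes _ = length xs
... | no _ = position xs y

nth-head : ∀ x xs → nth (x ∷ xs) (length xs) ≡ x
nth-head x xs with length xs ≟ length xs
... | yes _ = refl
... | no p = ⊥-elim (p refl)

nth-tail : ∀ x xs {n} → n ≢ length xs → nth (x ∷ xs) n ≡ nth xs n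
nth-tail x xs {n} n≢ with n ≟ length xs
... | yes p = ⊥-elim (n≢ p)
... | no _ = refl

<-tail : ∀ {n l} → n < suc l → n ≢ l → n < l
<-tail n< n≢ = ≤∧≢⇒< (≤-pred n<) n≢

nth-∈ : ∀ xs {n} → n < length xs → nth xs n ∈L xs
nth-∈ (x ∷ xs) {n} n< with n ≟ length xs
... | yes _ = here refl
... | no n≢ = there (nth-∈ xs (<-tail n< n≢))

position-< : ∀ xs {y} → y ∈L xs → position xs y < length xs
position-< (x ∷ xs) {y} p with y ≟ x
position-< (x ∷ xs) p | yes _ = n<1+n _
position-< (x ∷ xs) (here refl) | no y≢x = ⊥-elim (y≢x refl)
position-< (x ∷ xs) (there p) | no _ = m<n⇒m<1+n (position-< xs p)

nth-position : ∀ xs {y} → y ∈L xs → nth xs (position xs y) ≡ y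
nth-position (x ∷ xs) {y} p with y ≟ x
nth-position (x ∷ xs) p | yes refl = nth-head x xs
nth-position (x ∷ xs) (here refl) | no y≢x = ⊥-elim (y≢x refl)
nth-position (x ∷ xs) (there p) | no _ =
  trans (nth-tail x xs (<⇒≢ (position-< xs p))) (nth-position xs p)

position-nth : ∀ {xs} → Unique xs → ∀ {n} → n < length xs → position xs (nth xs n) ≡ n
position-nth {x ∷ xs} (x∉ ∷ u) {n} n< with n ≟ length xs
position-nth {x ∷ xs} (x∉ ∷ u) n< | yes refl with x ≟ x
... | yes _ = refl
... | no p = ⊥-elim (p refl)
position-nth {x ∷ xs} (x∉ ∷ u) {n} n< | no n≢ with nth xs n ≟ x
... | yes p = ⊥-elim (All.lookup x∉ (nth-∈ xs (<-tail n< n≢)) (sym p))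
... | no _ = position-nth u (<-tail n< n≢)

record VertexTerm {k : ℕ} (m : ℕ) : Set where
  field
    {bag} : Bag k
    {term} : Term k
    legal : Legal bag term
    bag⁺ : ∀ {x} → toℕ x < m → x ∈ bag
    bag⁻ : ∀ {x} → x ∈ bag → toℕ x < m
    nV≡ : nV (build term) ≡ m
    nE≡ : nE (build term) ≡ 0
    lab≡ : ∀ {x} → toℕ x < m → lab (build term) x ≡ just (toℕ x)
    V-spec : ∀ v → v ∈L V (graph (build term)) ⇔ v < m
    E≡[] : E (graph (build term)) ≡ []
    ρ≡[] : ρ (graph (build term)) ≡ []

vertexTerm : ∀ {k} m → m ≤ suc k → VertexTerm {k} m
vertexTerm zero _ = record
  { legal = Leaf ; bag⁺ = λ () ; bag⁻ = ⊥-elim ∘ ∉∅ ; nV≡ = refl ; nE≡ = refl ; lab≡ = λ ()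
  ; V-spec = λ v → (λ ()) , (λ ()) ; E≡[] = refl ; ρ≡[] = refl }
vertexTerm {k} (suc m) m<suc-k = record
  { legal = IntroVertex u u∉ T.legal
  ; bag⁺ = bag⁺'
  ; bag⁻ = bag⁻'
  ; nV≡ = cong suc T.nV≡
  ; nE≡ = T.nE≡
  ; lab≡ = lab≡'
  ; V-spec = λ v → V⁻ , V⁺
  ; E≡[] = T.E≡[]
  ; ρ≡[] = T.ρ≡[]
  }
  where
  module T = VertexTerm (vertexTerm {k} m (<⇒≤ m<suc-k))
  u : Fin (suc k)
  u = fromℕ< m<suc-k
  toℕ-u : toℕ u ≡ m
  toℕ-u = toℕ-fromℕ< m<suc-k
  u∉ : u ∉ T.bag
  u∉ p = <-irrefl toℕ-u (T.bag⁻ p)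
  module I = IntroVertexInvariant T.term u u∉ (invariant T.legal)
  old : ∀ {x} → toℕ x < suc m → x ≢ u → toℕ x < m
  old x< x≢u = <-tail x< (λ eq → x≢u (toℕ-injective (trans eq (sym toℕ-u))))
  bag⁺' : ∀ {x} → toℕ x < suc m → x ∈ T.bag [ u ]≔ inside
  bag⁺' {x} x< with x ≟F u
  ... | yes refl = ∈-update-inside u T.bag
  ... | no x≢u = ∈-update⁺ x≢u (T.bag⁺ (old x< x≢u))
  bag⁻' : ∀ {x} → x ∈ T.bag [ u ]≔ inside → toℕ x < suc m
  bag⁻' {x} x∈ with x ≟F u
  ... | yes refl = subst (_< suc m) (sym toℕ-u) (n<1+n m)
  ... | no x≢u = m<n⇒m<1+n (T.bag⁻ (∈-update⁻ x≢u x∈))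
  lab≡' : ∀ {x} → toℕ x < suc m → lab I.B' x ≡ just (toℕ x)
  lab≡' {x} x< = by-cases (x ≟F u)
    where
    by-cases : Dec (x ≡ u) → lab I.B' x ≡ just (toℕ x)
    by-cases (yes refl) = trans I.lab-new (cong just (trans T.nV≡ (sym toℕ-u)))
    by-cases (no x≢u) = trans (I.lab-old x≢u) (T.lab≡ (old x< x≢u))
  V⁻ : ∀ {v} → v ∈L V (graph I.B') → v < suc m
  V⁻ (here refl) = subst (_< suc m) (sym T.nV≡) (n<1+n m)
  V⁻ (there p) = m<n⇒m<1+n (proj₁ (T.V-spec _) p)
  V⁺ : ∀ {v} → v < suc m → v ∈L V (graph I.B')
  V⁺ {v} v< with v ≟ m
  ... | yes refl = here (sym T.nV≡)
  ... | no v≢m = there (proj₂ (T.V-spec v) (<-tail v< v≢m))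

module Representation (G : RawGraph) (isGraph : IsGraph G) where
  open IsGraph isGraph

  Vs Es : List ℕ
  Vs = deduplicate _≟_ (V G)
  Es = deduplicate _≟_ (E G)

  n : ℕ
  n = length Vs

  record Ends (e : ℕ) : Set where
    field
      u v : Fin (suc n)
      u≢v : u ≢ v
      u<n : toℕ u < n
      v<n : toℕ v < n
      ends : ∀ {w} → w < n → ((e , nth Vs w) ∈L ρ G) ⇔ (w ≡ toℕ u ⊎ w ≡ toℕ v)

  endsOf : ∀ {e} → e ∈L E G → Ends e
  endsOf {e} e∈ with twoEnds e∈
  ... | a , b , a≢b , ia , ib , only = record
    { u = label a∈ ; v = label b∈
    ; u≢v = λ eq → a≢b (trans (sym (nth-label a∈)) (trans (cong (nth Vs ∘ toℕ) eq) (nth-label b∈)))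
    ; u<n = label<n a∈ ; v<n = label<n b∈
    ; ends = λ w<n → to w<n , from w<n }
    where
    a∈ : a ∈L Vs
    a∈ = ∈-deduplicate⁺ _≟_ (proj₂ (ρ⊆E×V ia))
    b∈ : b ∈L Vs
    b∈ = ∈-deduplicate⁺ _≟_ (proj₂ (ρ⊆E×V ib))
    label : ∀ {x} → x ∈L Vs → Fin (suc n)
    label x∈ = fromℕ< (m<n⇒m<1+n (position-< Vs x∈))
    toℕ-label : ∀ {x} (x∈ : x ∈L Vs) → toℕ (label x∈) ≡ position Vs x
    toℕ-label x∈ = toℕ-fromℕ< _
    label<n : ∀ {x} (x∈ : x ∈L Vs) → toℕ (label x∈) < n
    label<n x∈ = subst (_< n) (sym (toℕ-label x∈)) (position-< Vs x∈)
    nth-label : ∀ {x} (x∈ : x ∈L Vs) → nth Vs (toℕ (label x∈)) ≡ x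
    nth-label x∈ = trans (cong (nth Vs) (toℕ-label x∈)) (nth-position Vs x∈)
    nth⇒label : ∀ {w x} (x∈ : x ∈L Vs) → w < n → nth Vs w ≡ x → w ≡ toℕ (label x∈)
    nth⇒label x∈ w<n eq = trans (sym (position-nth (DecUnique.deduplicate-! _≟_ (V G)) w<n))
      (trans (cong (position Vs) eq) (sym (toℕ-label x∈)))
    to : ∀ {w} → w < n → (e , nth Vs w) ∈L ρ G → w ≡ toℕ (label a∈) ⊎ w ≡ toℕ (label b∈)
    to w<n p with only _ p
    ... | inj₁ eq = inj₁ (nth⇒label a∈ w<n eq)
    ... | inj₂ eq = inj₂ (nth⇒label b∈ w<n eq)
    from : ∀ {w} → w < n → w ≡ toℕ (label a∈) ⊎ w ≡ toℕ (label b∈) → (e , nth Vs w) ∈L ρ G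
    from w<n (inj₁ refl) = subst (λ x → (e , x) ∈L ρ G) (sym (nth-label a∈)) ia
    from w<n (inj₂ refl) = subst (λ x → (e , x) ∈L ρ G) (sym (nth-label b∈)) ib

  record EdgeTerm (es : List ℕ) : Set where
    field
      {bag} : Bag n
      {term} : Term n
      legal : Legal bag term
      bag⁺ : ∀ {x} → toℕ x < n → x ∈ bag
      nE≡ : nE (build term) ≡ length es
      lab≡ : ∀ {x} → toℕ x < n → lab (build term) x ≡ just (toℕ x)
      V-spec : ∀ v → v ∈L V (graph (build term)) ⇔ v < n
      E-spec : ∀ e → e ∈L E (graph (build term)) ⇔ e < length es
      ρ-spec : ∀ e {w} → w < n →
        ((e , w) ∈L ρ (graph (build term))) ⇔ (e < length es × (nth es e , nth Vs w) ∈L ρ G)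

  edgeTerm : ∀ {es} → All Ends es → EdgeTerm es
  edgeTerm [] = record
    { legal = T.legal ; bag⁺ = T.bag⁺ ; nE≡ = T.nE≡ ; lab≡ = T.lab≡ ; V-spec = T.V-spec
    ; E-spec = λ e → (λ p → ⊥-elim (none (subst (e ∈L_) T.E≡[] p))) , (λ ())
    ; ρ-spec = λ e _ → (λ p → ⊥-elim (none (subst (_ ∈L_) T.ρ≡[] p))) , (λ ()) }
    where
    module T = VertexTerm (vertexTerm {n} n (n≤1+n n))
    none : ∀ {A : Set} {x : A} → x ∈L [] → ⊥
    none ()
  edgeTerm {e₀ ∷ es} (end ∷ all-ends) = record
    { term = IntroEdge u v T.term
    ; legal = IntroEdge u v u≢v (T.bag⁺ u<n) (T.bag⁺ v<n) T.legal
    ; bag⁺ = T.bag⁺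
    ; nE≡ = trans (cong nE build≡) (cong suc T.nE≡)
    ; lab≡ = λ {x} x< → trans (cong (λ B → lab B x) build≡) (T.lab≡ x<)
    ; V-spec = λ x → subst (λ B → x ∈L V (graph B) ⇔ x < n) (sym build≡) (T.V-spec x)
    ; E-spec = λ e → subst (λ B → e ∈L E (graph B) ⇔ e < suc (length es)) (sym build≡) (E-to , E-from)
    ; ρ-spec = λ e {w} w<n → subst (λ B → ((e , w) ∈L ρ (graph B)) ⇔
        (e < suc (length es) × (nth (e₀ ∷ es) e , nth Vs w) ∈L ρ G)) (sym build≡) (ρ-to w<n , ρ-from w<n)
    }
    where
    module T = EdgeTerm (edgeTerm all-ends)
    open Ends end
    B' : LGraph n
    B' = addEdge (toℕ u) (toℕ v) (build T.term)
    build≡ : build (IntroEdge u v T.term) ≡ B'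
    build≡ = build-IntroEdge u v T.term (T.lab≡ u<n) (T.lab≡ v<n)
    E-to : ∀ {e} → e ∈L E (graph B') → e < suc (length es)
    E-to (here refl) = subst (_< suc (length es)) (sym T.nE≡) (n<1+n _)
    E-to (there p) = m<n⇒m<1+n (proj₁ (T.E-spec _) p)
    E-from : ∀ {e} → e < suc (length es) → e ∈L E (graph B')
    E-from {e} e< with e ≟ length es
    ... | yes refl = here (sym T.nE≡)
    ... | no e≢ = there (proj₂ (T.E-spec e) (<-tail e< e≢))
    new : ∀ {w} → w < n → w ≡ toℕ u ⊎ w ≡ toℕ v →
      nE (build T.term) < suc (length es) × (nth (e₀ ∷ es) (nE (build T.term)) , nth Vs w) ∈L ρ G
    new {w} w<n p = subst (λ l → l < suc (length es) × (nth (e₀ ∷ es) l , nth Vs w) ∈L ρ G) (sym T.nE≡)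
      (n<1+n _ , subst (λ e → (e , nth Vs w) ∈L ρ G) (sym (nth-head e₀ es)) (proj₂ (ends w<n) p))
    ρ-to : ∀ {e w} → w < n → (e , w) ∈L ρ (graph B') →
      e < suc (length es) × (nth (e₀ ∷ es) e , nth Vs w) ∈L ρ G
    ρ-to w<n (here refl) = new w<n (inj₁ refl)
    ρ-to w<n (there (here refl)) = new w<n (inj₂ refl)
    ρ-to {e} {w} w<n (there (there p)) with proj₁ (T.ρ-spec e w<n) p
    ... | e< , q = m<n⇒m<1+n e< , subst (λ e → (e , nth Vs w) ∈L ρ G) (sym (nth-tail e₀ es (<⇒≢ e<))) q
    ρ-from : ∀ {e w} → w < n → e < suc (length es) × (nth (e₀ ∷ es) e , nth Vs w) ∈L ρ G →
      (e , w) ∈L ρ (graph B')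
    ρ-from {e} {w} w<n (e< , q) with e ≟ length es
    ρ-from {e} {w} w<n (e< , q) | no e≢ = there (there (proj₂ (T.ρ-spec e w<n) (<-tail e< e≢ , q)))
    ρ-from {e} {w} w<n (e< , q) | yes refl with proj₁ (ends w<n) q
    ... | inj₁ refl = here (cong (_, toℕ u) (sym T.nE≡))
    ... | inj₂ refl = there (here (cong (_, toℕ v) (sym T.nE≡)))

  open EdgeTerm (edgeTerm {Es} (All.tabulate (endsOf ∘ ∈-deduplicate⁻ _≟_ (E G)))) public

  iso : G⟦ term ⟧ ≅ G
  iso = record
    { fV = nth Vs ; gV = position Vs ; fE = nth Es ; gE = position Es
    ; fV∈ = λ p → ∈-deduplicate⁻ _≟_ (V G) (nth-∈ Vs (proj₁ (V-spec _) p))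
    ; gV∈ = λ p → proj₂ (V-spec _) (position-< Vs (∈-deduplicate⁺ _≟_ p))
    ; gfV = λ p → position-nth (DecUnique.deduplicate-! _≟_ (V G)) (proj₁ (V-spec _) p)
    ; fgV = λ p → nth-position Vs (∈-deduplicate⁺ _≟_ p)
    ; fE∈ = λ p → ∈-deduplicate⁻ _≟_ (E G) (nth-∈ Es (proj₁ (E-spec _) p))
    ; gE∈ = λ p → proj₂ (E-spec _) (position-< Es (∈-deduplicate⁺ _≟_ p))
    ; gfE = λ p → position-nth (DecUnique.deduplicate-! _≟_ (E G)) (proj₁ (E-spec _) p)
    ; fgE = λ p → nth-position Es (∈-deduplicate⁺ _≟_ p)
    ; pres = λ {e} {v} p q → (λ r → proj₂ (proj₁ (ρ-spec e (proj₁ (V-spec v) q)) r))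
                           , (λ r → proj₂ (ρ-spec e (proj₁ (V-spec v) q)) (proj₁ (E-spec e) p , r))
    }

module Property (S : Spec) where
  open CountingCore S
  open Semantics S
  open Correctness S

  inP⇔models : ∀ G → IsGraph G → InP countingCore G ⇔ Models G
  inP⇔models G isGraph =
      (λ (k , b , τ , l , a , i) → models-≅ i (proj₁ (accepts⇔models l) a))
    , (λ m → R.n , R.bag , R.term , R.legal , proj₂ (accepts⇔models R.legal) (models-≅ (≅-sym R.iso) m) , R.iso)
    where module R = Representation G isGraph

-- Selecting a set of vertices

indicator : ∀ {P : ℕ → Set} → Decidable P → ℕ → Fin 2
indicator P? v = if does (P? v) then suc zero else zero

indicator⁺ : ∀ {P : ℕ → Set} (P? : Decidable P) {v} → P v → T (bitOf (indicator P? v))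
indicator⁺ P? {v} p rewrite dec-true (P? v) p = tt

indicator⁻ : ∀ {P : ℕ → Set} (P? : Decidable P) {v} → T (bitOf (indicator P? v)) → P v
indicator⁻ P? {v} t with P? v
... | yes p = p

indicator-spec : ∀ {P : ℕ → Set} (P? : Decidable P) {G L} → (∀ {v} → v ∈L L → v ∈L V G) →
  (∀ {v} → v ∈L L ⇔ P v) → ∀ v → v ∈L L ⇔ (v ∈L V G × T (bitOf (indicator P? v)))
indicator-spec P? sub L⇔P v =
    (λ p → sub p , indicator⁺ P? (proj₁ L⇔P p))
  , (λ (_ , t) → proj₂ L⇔P (indicator⁻ P? t))

-- Satisfied when some n vertices can be selected so that at least m edges have
-- their two ends' selection bits combined to true by op. The vertex counter is
-- capped at n + 1, so that the value n is exact.
selection : (op : Bool → Bool → Bool) → (∀ x y → op x y ≡ op y x) → (n m bitsV bitsE : ℕ) →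
  suc (suc n) ≤ 2 ^ bitsV → suc m ≤ 2 ^ bitsE → Spec
selection op op-comm n m bitsV bitsE boundV boundE = record
  { colours = 2 ; capV = suc n ; capE = m ; colour₀ = zero
  ; wV = bitOf ; wE = λ a b → op (bitOf a) (bitOf b) ; wE-sym = λ a b → op-comm (bitOf a) (bitOf b)
  ; accept = λ x y → (x ≡ᵇ n) ∧ (m ≤ᵇ y)
  ; bitsL = 2 ; bitsV = bitsV ; bitsE = bitsE
  ; boundL = n≤1+n 3 ; boundV = boundV ; boundE = boundE }

⊓-suc⁻ : ∀ x n → x ⊓ suc n ≡ n → x ≡ n
⊓-suc⁻ x n eq with ≤-total x (suc n)
... | inj₁ x≤ = trans (sym (m≤n⇒m⊓n≡m x≤)) eq
... | inj₂ x≥ = ⊥-elim (1+n≢n (trans (sym (m≥n⇒m⊓n≡n x≥)) eq))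

module Selection (op : Bool → Bool → Bool) (op-comm : ∀ x y → op x y ≡ op y x) (n m bV bE : ℕ)
  (boundV : suc (suc n) ≤ 2 ^ bV) (boundE : suc m ≤ 2 ^ bE) where
  S : Spec
  S = selection op op-comm n m bV bE boundV boundE
  open CountingCore S public using (countingCore; goodCore; length-witness)
  open Semantics S public
  open Correctness S public
  open Property S public

  accepted⁻ : ∀ {L M} → Accepted L M → length L ≡ n × m ≤ length M
  accepted⁻ {L} {M} t with Equivalence.to T-∧ t
  ... | p , q = ⊓-suc⁻ (length L) n (≡ᵇ⇒≡ _ n p) , ≤-trans (≤ᵇ⇒≤ m _ q) (m⊓n≤m (length M) m)

  accepted⁺ : ∀ {L M} → length L ≡ n → m ≤ length M → Accepted L M
  accepted⁺ {L} {M} refl m≤ = Equivalence.from T-∧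
    ( ≡⇒≡ᵇ _ n (m≤n⇒m⊓n≡m (n≤1+n (length L)))
    , ≤⇒≤ᵇ (⊓-glb m≤ ≤-refl))

  heavyEdges-≥ : ∀ {G c xs} → Unique xs → (∀ {e} → e ∈L xs → e ∈L E G × Satisfies G c e) →
    length xs ≤ length (heavyEdgesOf G c)
  heavyEdges-≥ {G} {c} u sub = ⊆⇒length≤ u λ p → let e∈ , s = sub p in
    ∈-filter⁺ (satisfies? G c) (∈-deduplicate⁺ _≟_ e∈) s

other-end : ∀ {G e u v w} → IsGraph G → e ∈L E G → (e , u) ∈L ρ G → (e , v) ∈L ρ G → u ≢ v →
  (e , w) ∈L ρ G → w ≡ u ⊎ w ≡ v
other-end isG e∈ iu iv u≢v iw with IsGraph.twoEnds isG e∈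
... | a , b , _ , _ , _ , only with only _ iu | only _ iv | only _ iw
... | inj₁ refl | inj₁ refl | _ = ⊥-elim (u≢v refl)
... | inj₂ refl | inj₂ refl | _ = ⊥-elim (u≢v refl)
... | inj₁ refl | inj₂ refl | inj₁ refl = inj₁ refl
... | inj₁ refl | inj₂ refl | inj₂ refl = inj₂ refl
... | inj₂ refl | inj₁ refl | inj₁ refl = inj₂ refl
... | inj₂ refl | inj₁ refl | inj₂ refl = inj₁ refl

linear-bound : ∀ a b c {k l} → 1 ≤ k → 1 ≤ l → a + b * k + c * l ≤ (a + b + c) * (k * l)
linear-bound a b c {k} {l} 1≤k 1≤l = begin
  a + b * k + c * l ≤⟨ +-mono-≤ (+-mono-≤ (m≤m*n' a (*-mono-≤ 1≤k 1≤l)) (*-monoʳ-≤ b (m≤m*n' k 1≤l)))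
                        (*-monoʳ-≤ c (subst (_≤ k * l) (*-identityˡ l) (*-monoˡ-≤ l 1≤k))) ⟩
  a * (k * l) + b * (k * l) + c * (k * l) ≡⟨ distrib a b c (k * l) ⟩
  (a + b + c) * (k * l) ∎
  where
  open ≤-Reasoning
  m≤m*n' : ∀ x {y} → 1 ≤ y → x ≤ x * y
  m≤m*n' x {y} 1≤y = subst (_≤ x * y) (*-identityʳ x) (*-monoʳ-≤ x 1≤y)
  distrib : ∀ a b c p → a * p + b * p + c * p ≡ (a + b + c) * p
  distrib = solve-∀

-- Maximum degree

≤-foldr-⊔ : ∀ (f : ℕ → ℕ) {v} xs → v ∈L xs → f v ≤ foldr _⊔_ 0 (map f xs)
≤-foldr-⊔ f (x ∷ xs) (here refl) = m≤m⊔n (f x) _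
≤-foldr-⊔ f (x ∷ xs) (there p) = ≤-trans (≤-foldr-⊔ f xs p) (m≤n⊔m (f x) _)

foldr-⊔-attained : ∀ (f : ℕ → ℕ) {d} xs → 1 ≤ d → d ≤ foldr _⊔_ 0 (map f xs) → ∃ λ v → v ∈L xs × d ≤ f v
foldr-⊔-attained f [] 1≤d d≤ = ⊥-elim (<-irrefl refl (≤-trans 1≤d d≤))
foldr-⊔-attained f {d} (x ∷ xs) 1≤d d≤ with ≤-total (foldr _⊔_ 0 (map f xs)) (f x)
... | inj₁ q = x , here refl , subst (d ≤_) (m≥n⇒m⊔n≡m q) d≤
... | inj₂ q = let v , v∈ , d≤v = foldr-⊔-attained f xs 1≤d (subst (d ≤_) (m≤n⇒m⊔n≡n q) d≤) in v , there v∈ , d≤v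

incident : RawGraph → ℕ → List ℕ
incident G v = deduplicate _≟_ (filter (λ e → ∈?-with _≟ℕ×ℕ_ (e , v) (ρ G)) (E G))

incident⁺ : ∀ G {e v} → e ∈L E G → (e , v) ∈L ρ G → e ∈L incident G v
incident⁺ G {v = v} e∈ i = ∈-deduplicate⁺ _≟_ (∈-filter⁺ (λ e → ∈?-with _≟ℕ×ℕ_ (e , v) (ρ G)) e∈ i)

incident⁻ : ∀ G {e v} → e ∈L incident G v → e ∈L E G × (e , v) ∈L ρ G
incident⁻ G {v = v} p = ∈-filter⁻ (λ e → ∈?-with _≟ℕ×ℕ_ (e , v) (ρ G)) {xs = E G} (∈-deduplicate⁻ _≟_ _ p)

module MaxDegree (d : ℕ) (1≤d : 1 ≤ d) where
  open Selection _∨_ ∨-comm 1 d 2 ⌈log₂ (suc d) ⌉ (n≤1+n 3) (n≤2^⌈log₂n⌉ (suc d)) public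

  models⇒ : ∀ G → Models G → d ≤ maxDegree G
  models⇒ G (c , L , M , t , a) with accepted⁻ {L} {M} a
  models⇒ G (c , v ∷ [] , M , t , a) | refl , d≤ =
    ≤-trans d≤ (≤-trans (⊆⇒length≤ M-unique (λ {e} → incident-M {e}))
      (≤-foldr-⊔ (degree G) (V G) (proj₁ (proj₁ (L-spec v) (here refl)))))
    where
    open Tally t
    selected : ∀ {u} → u ∈L V G → T (bitOf (c u)) → u ≡ v
    selected {u} u∈ h with proj₂ (L-spec u) (u∈ , h)
    ... | here eq = eq
    incident-M : ∀ {e} → e ∈L M → e ∈L incident G v
    incident-M {e} p with proj₁ (M-spec e) p
    ... | e∈ , satisfies u∈ w∈ iu iw _ h with Equivalence.to T-∨ h
    ...   | inj₁ h' = incident⁺ G e∈ (subst (λ x → (e , x) ∈L ρ G) (selected u∈ h') iu)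
    ...   | inj₂ h' = incident⁺ G e∈ (subst (λ x → (e , x) ∈L ρ G) (selected w∈ h') iw)

  ⇒models : ∀ G → IsGraph G → d ≤ maxDegree G → Models G
  ⇒models G isG d≤ with foldr-⊔-attained (degree G) (V G) 1≤d d≤
  ... | v , v∈ , d≤v = c , v ∷ [] , heavyEdgesOf G c
    , tallyOf G c ([] ∷ []) (indicator-spec (_≟ v) {G} (λ { (here refl) → v∈ }) ((λ { (here eq) → eq }) , here))
    , accepted⁺ {v ∷ []} {heavyEdgesOf G c} refl
        (≤-trans d≤v (heavyEdges-≥ {G} {c} (DecUnique.deduplicate-! _≟_ _) sat))
    where
    open IsGraph isG
    c : Colouring
    c = indicator (_≟ v)
    sat : ∀ {e} → e ∈L incident G v → e ∈L E G × Satisfies G c e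
    sat p with incident⁻ G p
    ... | e∈ , i with twoEnds e∈
    ... | a , b , a≢b , ia , ib , only = e∈ , satisfies (proj₂ (ρ⊆E×V ia)) (proj₂ (ρ⊆E×V ib)) ia ib a≢b
      (Equivalence.from T-∨ (one (only v i)))
      where
      one : v ≡ a ⊎ v ≡ b → T (bitOf (c a)) ⊎ T (bitOf (c b))
      one (inj₁ refl) = inj₁ (indicator⁺ (_≟ v) refl)
      one (inj₂ refl) = inj₂ (indicator⁺ (_≟ v) refl)

-- Multiple edges

module MultipleEdges where
  open Selection _∧_ ∧-comm 2 2 2 2 ≤-refl (n≤1+n 3) public

  models⇒ : ∀ G → IsGraph G → Models G → HasMultipleEdge G
  models⇒ G isG (c , L , M , t , a) with accepted⁻ {L} {M} a
  models⇒ G isG (c , x ∷ y ∷ [] , M , t , a) | refl , 2≤ = two M 2≤ (Tally.M-unique t) (λ {e} → proj₁ (M-spec e))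
    where
    open Tally t using (L-unique; L-spec; M-spec)
    selected : ∀ {u} → u ∈L V G → T (bitOf (c u)) → u ≡ x ⊎ u ≡ y
    selected {u} u∈ h with proj₂ (L-spec u) (u∈ , h)
    ... | here eq = inj₁ eq
    ... | there (here eq) = inj₂ eq
    ends : ∀ {e} → e ∈L E G → Satisfies G c e → ∀ v → (e , v) ∈L ρ G ⇔ (v ≡ x ⊎ v ≡ y)
    ends {e} e∈ (satisfies u∈ w∈ iu iw u≢w h) v with Equivalence.to T-∧ h
    ... | hu , hw with selected u∈ hu | selected w∈ hw
    ...   | inj₁ refl | inj₁ refl = ⊥-elim (u≢w refl)
    ...   | inj₂ refl | inj₂ refl = ⊥-elim (u≢w refl)
    ...   | inj₁ refl | inj₂ refl = other-end isG e∈ iu iw u≢w , λ { (inj₁ refl) → iu ; (inj₂ refl) → iw }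
    ...   | inj₂ refl | inj₁ refl = other-end isG e∈ iw iu (u≢w ∘ sym) , λ { (inj₁ refl) → iw ; (inj₂ refl) → iu }
    two : ∀ M → 2 ≤ length M → Unique M → (∀ {e} → e ∈L M → e ∈L E G × Satisfies G c e) → HasMultipleEdge G
    two (e ∷ []) (s≤s ()) _ _
    two (e ∷ e' ∷ _) _ ((e≢e' ∷ _) ∷ _) sat with sat (here refl) | sat (there (here refl))
    ... | e∈ , s | e'∈ , s' = e , e' , e∈ , e'∈ , e≢e' , λ v →
        (λ p → proj₂ (ends e'∈ s' v) (proj₁ (ends e∈ s v) p))
      , (λ p → proj₂ (ends e∈ s v) (proj₁ (ends e'∈ s' v) p))

  ⇒models : ∀ G → IsGraph G → HasMultipleEdge G → Models G
  ⇒models G isG (e , e' , e∈ , e'∈ , e≢e' , same) with IsGraph.twoEnds isG e∈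
  ... | a , b , a≢b , ia , ib , _ = c , a ∷ b ∷ [] , heavyEdgesOf G c
    , tallyOf G c ((a≢b ∷ []) ∷ [] ∷ []) (indicator-spec P? {G} (λ { (here refl) → a∈ ; (there (here refl)) → b∈ })
        ((λ { (here eq) → inj₁ eq ; (there (here eq)) → inj₂ eq }) , λ { (inj₁ eq) → here eq ; (inj₂ eq) → there (here eq) }))
    , accepted⁺ {a ∷ b ∷ []} {heavyEdgesOf G c} refl (heavyEdges-≥ {G} {c} {e ∷ e' ∷ []} ((e≢e' ∷ []) ∷ [] ∷ [])
        λ { (here refl) → e∈ , sat ia ib ; (there (here refl)) → e'∈ , sat (proj₁ (same a) ia) (proj₁ (same b) ib) })
    where
    open IsGraph isG
    P? : Decidable (λ v → v ≡ a ⊎ v ≡ b)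
    P? v = (v ≟ a) ⊎-dec (v ≟ b)
    c : Colouring
    c = indicator P?
    a∈ : a ∈L V G
    a∈ = proj₂ (ρ⊆E×V ia)
    b∈ : b ∈L V G
    b∈ = proj₂ (ρ⊆E×V ib)
    sat : ∀ {e} → (e , a) ∈L ρ G → (e , b) ∈L ρ G → Satisfies G c e
    sat ia ib = satisfies a∈ b∈ ia ib a≢b
      (Equivalence.from T-∧ (indicator⁺ P? (inj₁ refl) , indicator⁺ P? (inj₂ refl)))

-- Cliques

pairs : List ℕ → List (ℕ × ℕ)
pairs [] = []
pairs (x ∷ xs) = map (x ,_) xs ++ pairs xs

triangular : ℕ → ℕ
triangular zero = 0
triangular (suc n) = n + triangular n

length-pairs : ∀ xs → length (pairs xs) ≡ triangular (length xs)
length-pairs [] = refl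
length-pairs (x ∷ xs) = trans (length-++ (map (x ,_) xs)) (cong₂ _+_ (length-map (x ,_) xs) (length-pairs xs))

pairs-⊆ : ∀ xs {x y} → (x , y) ∈L pairs xs → x ∈L xs × y ∈L xs
pairs-⊆ (z ∷ xs) p with ∈-++⁻ (map (z ,_) xs) p
... | inj₂ q = let x∈ , y∈ = pairs-⊆ xs q in there x∈ , there y∈
... | inj₁ q with ∈-map⁻ (z ,_) q
...   | _ , y∈ , refl = here refl , there y∈

pairs-total : ∀ xs {x y} → x ∈L xs → y ∈L xs → x ≢ y → (x , y) ∈L pairs xs ⊎ (y , x) ∈L pairs xs
pairs-total (z ∷ xs) (here refl) (here refl) x≢y = ⊥-elim (x≢y refl)
pairs-total (z ∷ xs) (here refl) (there q) x≢y = inj₁ (∈-++⁺ˡ (∈-map⁺ (z ,_) q))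
pairs-total (z ∷ xs) (there p) (here refl) x≢y = inj₂ (∈-++⁺ˡ (∈-map⁺ (z ,_) p))
pairs-total (z ∷ xs) (there p) (there q) x≢y with pairs-total xs p q x≢y
... | inj₁ r = inj₁ (∈-++⁺ʳ (map (z ,_) xs) r)
... | inj₂ r = inj₂ (∈-++⁺ʳ (map (z ,_) xs) r)

pairs-asym : ∀ {xs} → Unique xs → ∀ {x y} → (x , y) ∈L pairs xs → ¬ (y , x) ∈L pairs xs
pairs-asym {z ∷ xs} (z∉ ∷ u) p q with ∈-++⁻ (map (z ,_) xs) p | ∈-++⁻ (map (z ,_) xs) q
... | inj₂ p' | inj₂ q' = pairs-asym u p' q'
... | inj₁ p' | inj₂ q' with ∈-map⁻ (z ,_) p'
...   | _ , _ , refl = All.lookup z∉ (proj₂ (pairs-⊆ xs q')) refl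
pairs-asym {z ∷ xs} (z∉ ∷ u) p q | inj₂ p' | inj₁ q' with ∈-map⁻ (z ,_) q'
...   | _ , _ , refl = All.lookup z∉ (proj₂ (pairs-⊆ xs p')) refl
pairs-asym {z ∷ xs} (z∉ ∷ u) p q | inj₁ p' | inj₁ q' with ∈-map⁻ (z ,_) p' | ∈-map⁻ (z ,_) q'
...   | _ , y∈ , refl | _ , _ , refl = All.lookup z∉ y∈ refl

pairs-irrefl : ∀ {xs} → Unique xs → ∀ {x y} → (x , y) ∈L pairs xs → x ≢ y
pairs-irrefl u p refl = pairs-asym u p p

pairs-unique : ∀ {xs} → Unique xs → Unique (pairs xs)
pairs-unique [] = []
pairs-unique {z ∷ xs} (z∉ ∷ u) = Unique.++⁺ (Unique.map⁺ (λ { refl → refl }) u) (pairs-unique u) disjoint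
  where
  disjoint : ∀ {p} → ¬ (p ∈L map (z ,_) xs × p ∈L pairs xs)
  disjoint (p , q) with ∈-map⁻ (z ,_) p
  ... | _ , _ , refl = All.lookup z∉ (proj₁ (pairs-⊆ xs q)) refl

triangular<square : ∀ n → suc (triangular (suc n)) ≤ suc n * suc n
triangular<square zero = ≤-refl
triangular<square (suc n) = begin
  suc (suc n + triangular (suc n)) ≡⟨ +-suc (suc n) (triangular (suc n)) ⟨
  suc n + suc (triangular (suc n)) ≤⟨ +-mono-≤ (n≤1+n (suc n)) (triangular<square n) ⟩
  suc (suc n) + suc n * suc n ≤⟨ +-monoʳ-≤ (suc (suc n)) (*-monoʳ-≤ (suc n) (n≤1+n (suc n))) ⟩
  suc (suc n) + suc n * suc (suc n) ∎
  where open ≤-Reasoning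

clique-boundV : ∀ {ω} → 2 ≤ ω → suc (suc ω) ≤ 2 ^ suc ⌈log₂ ω ⌉
clique-boundV {ω} 2≤ω = begin
  2 + ω ≤⟨ +-monoˡ-≤ ω 2≤ω ⟩
  ω + ω ≡⟨ cong (ω +_) (+-identityʳ ω) ⟨
  2 * ω ≤⟨ *-monoʳ-≤ 2 (n≤2^⌈log₂n⌉ ω) ⟩
  2 ^ suc ⌈log₂ ω ⌉ ∎
  where open ≤-Reasoning

clique-boundE : ∀ {ω} → 2 ≤ ω → suc (triangular ω) ≤ 2 ^ (⌈log₂ ω ⌉ + ⌈log₂ ω ⌉)
clique-boundE {ω@(suc n)} _ = begin
  suc (triangular ω) ≤⟨ triangular<square n ⟩
  ω * ω ≤⟨ *-mono-≤ (n≤2^⌈log₂n⌉ ω) (n≤2^⌈log₂n⌉ ω) ⟩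
  2 ^ ⌈log₂ ω ⌉ * 2 ^ ⌈log₂ ω ⌉ ≡⟨ ^-distribˡ-+-* 2 ⌈log₂ ω ⌉ ⌈log₂ ω ⌉ ⟨
  2 ^ (⌈log₂ ω ⌉ + ⌈log₂ ω ⌉) ∎
  where open ≤-Reasoning

Joins : RawGraph → ℕ → ℕ × ℕ → Set
Joins G e (x , y) = (e ∈L E G) × ((e , x) ∈L ρ G) × ((e , y) ∈L ρ G)

joins? : ∀ G p → Dec (∃ λ e → Joins G e p)
joins? G (x , y) = map′ find (λ (_ , e∈ , i) → lose e∈ i)
  (Any.any? (λ e → ∈?-with _≟ℕ×ℕ_ (e , x) (ρ G) ×-dec ∈?-with _≟ℕ×ℕ_ (e , y) (ρ G)) (E G))

simple-joins : ∀ {G} → IsGraph G → Simple G → ∀ {e e' x y} → x ≢ y →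
  Joins G e (x , y) → Joins G e' (x , y) → e ≡ e'
simple-joins {G} isG simple {e} {e'} x≢y (e∈ , ix , iy) (e'∈ , ix' , iy') with e ≟ e'
... | yes eq = eq
... | no e≢e' = ⊥-elim (simple (e , e' , e∈ , e'∈ , e≢e' , λ v →
    (λ p → transfer (other-end isG e∈ ix iy x≢y p) ix' iy')
  , (λ p → transfer (other-end isG e'∈ ix' iy' x≢y p) ix iy)))
  where
  transfer : ∀ {e v x y} → v ≡ x ⊎ v ≡ y → (e , x) ∈L ρ G → (e , y) ∈L ρ G → (e , v) ∈L ρ G
  transfer (inj₁ refl) p q = p
  transfer (inj₂ refl) p q = q

module Clique (ω : ℕ) (2≤ω : 2 ≤ ω) where
  open Selection _∧_ ∧-comm ω (triangular ω) (suc ⌈log₂ ω ⌉) (⌈log₂ ω ⌉ + ⌈log₂ ω ⌉)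
    (clique-boundV 2≤ω) (clique-boundE 2≤ω) public

  -- In a simple graph, edges inject into the pairs they join; as there are at
  -- least as many edges as pairs, no pair can be missed.
  models⇒ : ∀ G → IsGraph G → Simple G → Models G → HasClique ω G
  models⇒ G isG simple (c , L , M , t , a) with accepted⁻ {L} {M} a
  ... | length≡ , enough = L , L-unique , length≡ , All.tabulate (λ {v} p → proj₁ (proj₁ (L-spec v) p)) , adjacent
    where
    open Tally t
    heavy : ∀ {e} → e ∈L M → ∃ λ p → p ∈L pairs L × Joins G e p
    heavy {e} p with proj₁ (M-spec e) p
    ... | e∈ , satisfies u∈ v∈ iu iv u≢v h with Equivalence.to T-∧ h
    ... | hu , hv with pairs-total L (proj₂ (L-spec _) (u∈ , hu)) (proj₂ (L-spec _) (v∈ , hv)) u≢v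
    ...   | inj₁ q = _ , q , e∈ , iu , iv
    ...   | inj₂ q = _ , q , e∈ , iv , iu
    joined : ∀ {p} → p ∈L pairs L → ∃ λ e → Joins G e p
    joined {p} p∈ with joins? G p
    ... | yes j = j
    ... | no ¬j = ⊥-elim (<-irrefl refl (begin-strict
      length (pairs L ─ p∈) <⟨ n<1+n _ ⟩
      suc (length (pairs L ─ p∈)) ≡⟨ length-─ p∈ ⟩
      length (pairs L) ≡⟨ length-pairs L ⟩
      triangular (length L) ≡⟨ cong triangular length≡ ⟩
      triangular ω ≤⟨ enough ⟩
      length M ≤⟨ injection⇒length≤ R M (pairs L ─ p∈) M-unique avoid
                    (λ { _ _ (x≢y , j) (_ , j') → simple-joins isG simple x≢y j j' }) ⟩
      length (pairs L ─ p∈) ∎))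
      where
      open ≤-Reasoning
      R : ℕ → ℕ × ℕ → Set
      R e q = proj₁ q ≢ proj₂ q × Joins G e q
      avoid : ∀ {e} → e ∈L M → ∃ λ q → q ∈L (pairs L ─ p∈) × R e q
      avoid {e} e∈M with heavy e∈M
      ... | q , q∈ , j = q , ∈-─ p∈ q∈ (λ { refl → ¬j (e , j) }) , pairs-irrefl L-unique q∈ , j
    adjacent : ∀ {x y} → x ∈L L → y ∈L L → x ≢ y → Adjacent G x y
    adjacent x∈ y∈ x≢y with pairs-total L x∈ y∈ x≢y
    ... | inj₁ p = joined p
    ... | inj₂ p = let e , e∈ , iy , ix = joined p in e , e∈ , ix , iy

  ⇒models : ∀ G → IsGraph G → HasClique ω G → Models G
  ⇒models G isG (K , K-unique , refl , K⊆V , adjacent) = c , K , heavyEdgesOf G c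
    , tallyOf G c K-unique (indicator-spec P? {G} (All.lookup K⊆V) (id , id))
    , accepted⁺ {K} {heavyEdgesOf G c} refl (subst (_≤ length (heavyEdgesOf G c)) (length-pairs K)
        (injection⇒length≤ (λ p e → Joins G e p) (pairs K) (heavyEdgesOf G c) (pairs-unique K-unique) total injective))
    where
    P? : Decidable (_∈L K)
    P? v = ∈?-with _≟_ v K
    c : Colouring
    c = indicator P?
    total : ∀ {p} → p ∈L pairs K → ∃ λ e → e ∈L heavyEdgesOf G c × Joins G e p
    total {x , y} p = let x∈ , y∈ = pairs-⊆ K p
                          x≢y = pairs-irrefl K-unique p
                          e , e∈ , ix , iy = adjacent x∈ y∈ x≢y in
      e , ∈-filter⁺ (satisfies? G c) (∈-deduplicate⁺ _≟_ e∈)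
            (satisfies (All.lookup K⊆V x∈) (All.lookup K⊆V y∈) ix iy x≢y
              (Equivalence.from T-∧ (indicator⁺ P? x∈ , indicator⁺ P? y∈)))
        , e∈ , ix , iy
    injective : ∀ {p q e} → p ∈L pairs K → q ∈L pairs K → Joins G e p → Joins G e q → p ≡ q
    injective p∈ q∈ (e∈ , ix , iy) (_ , ix' , iy')
      with other-end isG e∈ ix iy (pairs-irrefl K-unique p∈) ix' | other-end isG e∈ ix iy (pairs-irrefl K-unique p∈) iy'
    ... | inj₁ refl | inj₂ refl = refl
    ... | inj₂ refl | inj₁ refl = ⊥-elim (pairs-asym K-unique p∈ q∈)
    ... | inj₁ refl | inj₁ refl = ⊥-elim (pairs-irrefl K-unique q∈ refl)
    ... | inj₂ refl | inj₂ refl = ⊥-elim (pairs-irrefl K-unique q∈ refl)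

-- Colourability

chromatic : (r : ℕ) → 1 ≤ r → Spec
chromatic r 1≤r = record
  { colours = r ; capV = 0 ; capE = 1 ; colour₀ = fromℕ< 1≤r
  ; wV = λ _ → false ; wE = λ a b → ⌊ a ≟F b ⌋ ; wE-sym = symmetric
  ; accept = λ _ y → y ≡ᵇ 0
  ; bitsL = ⌈log₂ (suc r) ⌉ ; bitsV = 0 ; bitsE = 1
  ; boundL = n≤2^⌈log₂n⌉ (suc r) ; boundV = ≤-refl ; boundE = ≤-refl }
  where
  symmetric : (a b : Fin r) → ⌊ a ≟F b ⌋ ≡ ⌊ b ≟F a ⌋
  symmetric a b with a ≟F b | b ≟F a
  ... | yes _ | yes _ = refl
  ... | no _ | no _ = refl
  ... | yes p | no q = ⊥-elim (q (sym p))
  ... | no p | yes q = ⊥-elim (p (sym q))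

module Chromatic (r : ℕ) (1≤r : 1 ≤ r) where
  S : Spec
  S = chromatic r 1≤r
  open CountingCore S public using (countingCore; goodCore; length-witness)
  open Semantics S public
  open Correctness S public
  open Property S public

  models⇒ : ∀ G → Models G → Colorable r G
  models⇒ G (c , L , [] , t , _) = (λ v _ → c v) , λ {e} pu pv e∈ iu iv u≢v eq →
    none (proj₂ (Tally.M-spec t e) (e∈ , satisfies pu pv iu iv u≢v (fromWitness eq)))
    where
    none : ∀ {e : ℕ} → e ∈L [] → ⊥
    none ()

  ⇒models : ∀ G → Colorable r G → Models G
  ⇒models G (col , proper) = c , [] , heavyEdgesOf G c
    , tallyOf G c [] (λ v → (λ ()) , (λ ())) , accepted (heavyEdgesOf G c) light
    where
    c : Colouring
    c v with ∈?-with _≟_ v (V G)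
    ... | yes p = col v p
    ... | no _ = fromℕ< 1≤r
    c≡col : ∀ {v} → v ∈L V G → ∃ λ p → c v ≡ col v p
    c≡col {v} v∈ with ∈?-with _≟_ v (V G)
    ... | yes p = p , refl
    ... | no v∉ = ⊥-elim (v∉ v∈)
    light : ∀ {e} → ¬ e ∈L heavyEdgesOf G c
    light p with ∈-filter⁻ (satisfies? G c) {xs = deduplicate _≟_ (E G)} p
    ... | e∈ , satisfies u∈ v∈ iu iv u≢v h with c≡col u∈ | c≡col v∈
    ... | pu , eu | pv , ev = proper pu pv (∈-deduplicate⁻ _≟_ (E G) e∈) iu iv u≢v
      (trans (sym eu) (trans (toWitness h) ev))
    accepted : ∀ M → (∀ {e} → ¬ e ∈L M) → Accepted [] M
    accepted [] _ = tt
    accepted (_ ∷ _) none = ⊥-elim (none (here refl))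

theorem8 :
  -- 1. MaxDeg_{≥ d}
  (∃₂ λ C N → ∀ d → 1 ≤ d → ∃ λ (D : DPCore) →
      GoodCore D
    × BitLength D (λ k → k * ⌈log₂ (suc d)⌉) C N
    × (∀ G → IsGraph G → (InP D G ⇔ d ≤ maxDegree G))
    × Coherent D)
  -- 2. Chrom_{≤ r}
  × (∃₂ λ C N → ∀ r → 1 ≤ r → ∃ λ (D : DPCore) →
      GoodCore D
    × BitLength D (λ k → k * ⌈log₂ (suc r)⌉) C N
    × (∀ G → IsGraph G → (InP D G ⇔ Colorable r G))
    × Coherent D)
  -- 3. SimpleClique_{≥ ω}
  × (∃₂ λ C N → ∀ ω → 2 ≤ ω → ∃ λ (D : DPCore) →
      GoodCore D
    × BitLength D (λ k → k * ⌈log₂ ω ⌉) C N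
    × (∀ G → IsGraph G → Simple G → (InP D G ⇔ HasClique ω G)))
  -- 4. HasMultipleEdges
  × (∃₂ λ C N → ∃ λ (D : DPCore) →
      GoodCore D
    × BitLength D (λ k → k * k) C N
    × (∀ G → IsGraph G → (InP D G ⇔ HasMultipleEdge G))
    × Coherent D)
theorem8 = (7 , 1 , maxDegreeCore) , (3 , 1 , chromaticCore) , (8 , 1 , cliqueCore) , (8 , 1 , multipleEdgesCore)
  where
  infixr 3 _⨾_
  _⨾_ : ∀ {A B C : Set} → A ⇔ B → B ⇔ C → A ⇔ C
  (f , g) ⨾ (f' , g') = f' ∘ f , g ∘ g'
  maxDegreeCore : ∀ d → 1 ≤ d → ∃ λ (D : DPCore) → GoodCore D
    × BitLength D (λ k → k * ⌈log₂ (suc d)⌉) 7 1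
    × (∀ G → IsGraph G → (InP D G ⇔ d ≤ maxDegree G)) × Coherent D
  maxDegreeCore d 1≤d = countingCore , goodCore , bound ,
    (λ G isG → inP⇔models G isG ⨾ models⇒ G , ⇒models G isG) , coherent
    where
    open MaxDegree d 1≤d
    arith : ∀ k l → suc k * 2 + (2 + l) ≡ 4 + 2 * k + 1 * l
    arith = solve-∀
    bound : BitLength countingCore (λ k → k * ⌈log₂ (suc d)⌉) 7 1
    bound k 1≤k w v = subst (_≤ _) (sym (trans (length-witness k w v) (arith k ⌈log₂ (suc d)⌉)))
      (linear-bound 4 2 1 1≤k (1≤⌈log₂⌉ (s≤s 1≤d)))
  chromaticCore : ∀ r → 1 ≤ r → ∃ λ (D : DPCore) → GoodCore D
    × BitLength D (λ k → k * ⌈log₂ (suc r)⌉) 3 1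
    × (∀ G → IsGraph G → (InP D G ⇔ Colorable r G)) × Coherent D
  chromaticCore r 1≤r = countingCore , goodCore , bound ,
    (λ G isG → inP⇔models G isG ⨾ models⇒ G , ⇒models G) , coherent
    where
    open Chromatic r 1≤r
    arith : ∀ k l → suc k * l + (0 + 1) ≡ k * l + (1 + 0 * k + 1 * l)
    arith = solve-∀
    bound : BitLength countingCore (λ k → k * ⌈log₂ (suc r)⌉) 3 1
    bound k 1≤k w v = subst (_≤ _) (sym (trans (length-witness k w v) (arith k ⌈log₂ (suc r)⌉)))
      (+-monoʳ-≤ (k * ⌈log₂ (suc r)⌉) (linear-bound 1 0 1 1≤k (1≤⌈log₂⌉ (s≤s 1≤r))))
  cliqueCore : ∀ ω → 2 ≤ ω → ∃ λ (D : DPCore) → GoodCore D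
    × BitLength D (λ k → k * ⌈log₂ ω ⌉) 8 1
    × (∀ G → IsGraph G → Simple G → (InP D G ⇔ HasClique ω G))
  cliqueCore ω 2≤ω = countingCore , goodCore , bound ,
    (λ G isG simple → inP⇔models G isG ⨾ models⇒ G isG simple , ⇒models G isG)
    where
    open Clique ω 2≤ω
    arith : ∀ k l → suc k * 2 + (suc l + (l + l)) ≡ 3 + 2 * k + 3 * l
    arith = solve-∀
    bound : BitLength countingCore (λ k → k * ⌈log₂ ω ⌉) 8 1
    bound k 1≤k w v = subst (_≤ _) (sym (trans (length-witness k w v) (arith k ⌈log₂ ω ⌉)))
      (linear-bound 3 2 3 1≤k (1≤⌈log₂⌉ 2≤ω))
  multipleEdgesCore : ∃ λ (D : DPCore) → GoodCore D
    × BitLength D (λ k → k * k) 8 1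
    × (∀ G → IsGraph G → (InP D G ⇔ HasMultipleEdge G)) × Coherent D
  multipleEdgesCore = countingCore , goodCore , bound ,
    (λ G isG → inP⇔models G isG ⨾ models⇒ G isG , ⇒models G isG) , coherent
    where
    open MultipleEdges
    arith : ∀ k → suc k * 2 + (2 + 2) ≡ 6 + 2 * k + 0 * k
    arith = solve-∀
    bound : BitLength countingCore (λ k → k * k) 8 1
    bound k 1≤k w v = subst (_≤ _) (sym (trans (length-witness k w v) (arith k))) (linear-bound 6 2 0 1≤k 1≤k)
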